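{- Let $T$ and $V$ be any two length-$n$ reflection factorizations of elements in $G_7$. Then $T$ and $V$ are Hurwitz equivalent if and only if they factor the same element, generate the same subgroup $H$ of $G_7$, and have the same multiset of conjugacy classes (of $H$).
   Context: Let $G_7$ be the subgroup of $GL_2(\mathbb{C})$ generated by $s=\begin{bmatrix}1&0\\0&-1\end{bmatrix}$, $t=\frac14\begin{bmatrix}(1+\sqrt3)+(-1+\sqrt3)i & (1+\sqrt3)+(-1+\sqrt3)i\\ (-1+\sqrt3)-(1+\sqrt3)i & (1-\sqrt3)+(1+\sqrt3)i\end{bmatrix}$ and $u=t^{\top}$; it has presentation $\langle s,t,u\mid s^2=t^3=u^3=1,\ stu=ust=tus\rangle$ and order $144$. A reflection is a linear map $\mathbb{C}^2\to\mathbb{C}^2$ whose fixed space has dimension $1$. For a group $H\le G_7$, a reflection factorization of $g\in H$ of length $n$ is a tuple $(r_1,\dots,r_n)$ of reflections lying in $H$ with $r_1\cdots r_n=g$; it generates the subgroup $\langle r_1,\dots,r_n\rangle$. The Hurwitz move $\sigma_i$ ($1\le i<n$) sends $(r_1,\dots,r_n)$ to $(r_1,\dots,r_{i-1},r_{i+1},r_{i+1}^{ -1}r_ir_{i+1},r_{i+2},\dots,r_n)$. Two factorizations are Hurwitz equivalent if one is obtained from the other by a finite sequence of Hurwitz moves; the Hurwitz orbit of $T$ is the set of factorizations Hurwitz equivalent to $T$. If a factorization $T$ generates the subgroup $H$, its multiset of conjugacy classes is the multiset of $H$-conjugacy classes of its entries (each class counted with the number of entries of $T$ lying in it). -}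

module Defs where

open import Algebra.Bundles using (CommutativeRing; Monoid; Group)
import Algebra.Consequences.Setoid as Consequences
import Algebra.Properties.Group as GroupProperties
import Algebra.Solver.Ring.NaturalCoefficients.Default as SemiringSolver
open import Data.Fin.Base using (Fin; zero; suc)
open import Data.Integer.Base using (+_; -[1+_])
open import Data.List.Base using (List; foldl)
import Data.List.Relation.Binary.Permutation.Setoid as Permutation
open import Data.Nat.Base using (ℕ; zero; suc; pred)
open import Data.Product.Base using (_×_; _,_; ∃-syntax)
open import Data.Rational.Base using (_/_)
import Data.Rational.Properties as ℚ
open import Data.Sum.Base using (_⊎_)
open import Data.Vec.Base using (Vec; []; _∷_; foldr′; toList)
import Data.Vec.Membership.Setoid as Membership
import Data.Vec.Relation.Binary.Equality.Setoid as VecEquality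
open import Data.Vec.Relation.Unary.All using (All)
open import Function.Base using (flip)
open import Level using (Level; 0ℓ; _⊔_)
open import Relation.Binary.Bundles using (Setoid)
open import Relation.Binary.PropositionalEquality.Core using (refl)
import Relation.Binary.Reasoning.Setoid as SetoidReasoning
open import Relation.Nullary.Negation.Core using (¬_)
open import Relation.Unary using (Pred; _∈_; _≐_)

private
  variable
    c ℓ : Level
    n : ℕ

-- The ring R[X]/(X² - d), with x ⊕ y √d standing for x + y√d.
module QuadraticExtension (R : CommutativeRing c ℓ) (d : CommutativeRing.Carrier R) where
  private
    module R = CommutativeRing R
    open SemiringSolver R.commutativeSemiring using (solve; _:=_; _:+_; _:*_)

  infix 5 _⊕_√d
  record Carrier : Set c where
    constructor _⊕_√d
    field
      base surd : R.Carrier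
  open Carrier public

  infix  8 -_
  infixl 7 _*_
  infixl 6 _+_
  infix  4 _≈_

  _≈_ : Carrier → Carrier → Set ℓ
  x ≈ y = base x R.≈ base y × surd x R.≈ surd y

  _+_ : Carrier → Carrier → Carrier
  x + y = base x R.+ base y ⊕ surd x R.+ surd y √d

  _*_ : Carrier → Carrier → Carrier
  x * y = base x R.* base y R.+ d R.* (surd x R.* surd y)
        ⊕ base x R.* surd y R.+ surd x R.* base y √d

  -_ : Carrier → Carrier
  - x = R.- base x ⊕ R.- surd x √d

  embed : R.Carrier → Carrier
  embed r = r ⊕ R.0# √d

  √d : Carrier
  √d = R.0# ⊕ R.1# √d

  private
    setoid : Setoid c ℓ
    setoid = record
      { _≈_ = _≈_
      ; isEquivalence = record
        { refl  = R.refl , R.refl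
        ; sym   = λ (p , q) → R.sym p , R.sym q
        ; trans = λ (p , q) (p′ , q′) → R.trans p p′ , R.trans q q′
        }
      }

    open Consequences setoid using (comm∧idˡ⇒id; comm∧distrˡ⇒distr)

    +-cong : ∀ {x x′ y y′} → x ≈ x′ → y ≈ y′ → x + y ≈ x′ + y′
    +-cong (p , q) (p′ , q′) = R.+-cong p p′ , R.+-cong q q′

    *-cong : ∀ {x x′ y y′} → x ≈ x′ → y ≈ y′ → x * y ≈ x′ * y′
    *-cong (p , q) (p′ , q′) =
        R.+-cong (R.*-cong p p′) (R.*-congˡ (R.*-cong q q′))
      , R.+-cong (R.*-cong p q′) (R.*-cong q p′)

    *-comm : ∀ x y → x * y ≈ y * x
    *-comm x y =
        R.+-cong (R.*-comm _ _) (R.*-congˡ (R.*-comm _ _))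
      , R.trans (R.+-comm _ _) (R.+-cong (R.*-comm _ _) (R.*-comm _ _))

    *-assoc : ∀ x y z → (x * y) * z ≈ x * (y * z)
    *-assoc (a ⊕ b √d) (a′ ⊕ b′ √d) (a″ ⊕ b″ √d) =
        solve 7 (λ a b a′ b′ a″ b″ d →
          ((a :* a′ :+ d :* (b :* b′)) :* a″ :+ d :* ((a :* b′ :+ b :* a′) :* b″))
          := (a :* (a′ :* a″ :+ d :* (b′ :* b″)) :+ d :* (b :* (a′ :* b″ :+ b′ :* a″))))
          R.refl a b a′ b′ a″ b″ d
      , solve 7 (λ a b a′ b′ a″ b″ d →
          ((a :* a′ :+ d :* (b :* b′)) :* b″ :+ (a :* b′ :+ b :* a′) :* a″)
          := (a :* (a′ :* b″ :+ b′ :* a″) :+ b :* (a′ :* a″ :+ d :* (b′ :* b″))))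
          R.refl a b a′ b′ a″ b″ d

    *-identityˡ : ∀ x → embed R.1# * x ≈ x
    *-identityˡ (a ⊕ b √d) =
        R.trans (R.+-cong (R.*-identityˡ a) (R.trans (R.*-congˡ (R.zeroˡ b)) (R.zeroʳ d)))
                (R.+-identityʳ a)
      , R.trans (R.+-cong (R.*-identityˡ b) (R.zeroˡ a)) (R.+-identityʳ b)

    *-distribˡ-+ : ∀ x y z → x * (y + z) ≈ (x * y) + (x * z)
    *-distribˡ-+ (a ⊕ b √d) (a′ ⊕ b′ √d) (a″ ⊕ b″ √d) =
        solve 7 (λ a b a′ b′ a″ b″ d →
          (a :* (a′ :+ a″) :+ d :* (b :* (b′ :+ b″)))
          := ((a :* a′ :+ d :* (b :* b′)) :+ (a :* a″ :+ d :* (b :* b″))))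
          R.refl a b a′ b′ a″ b″ d
      , solve 7 (λ a b a′ b′ a″ b″ d →
          (a :* (b′ :+ b″) :+ b :* (a′ :+ a″))
          := ((a :* b′ :+ b :* a′) :+ (a :* b″ :+ b :* a″)))
          R.refl a b a′ b′ a″ b″ d

  commutativeRing : CommutativeRing c ℓ
  commutativeRing = record
    { Carrier = Carrier
    ; _≈_ = _≈_
    ; _+_ = _+_
    ; _*_ = _*_
    ; -_  = -_
    ; 0#  = embed R.0#
    ; 1#  = embed R.1#
    ; isCommutativeRing = record
      { isRing = record
        { +-isAbelianGroup = record
          { isGroup = record
            { isMonoid = record
              { isSemigroup = record
                { isMagma = record
                  { isEquivalence = Setoid.isEquivalence setoid
                  ; ∙-cong = +-cong
                  }
                ; assoc = λ x y z → R.+-assoc _ _ _ , R.+-assoc _ _ _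
                }
              ; identity = (λ x → R.+-identityˡ _ , R.+-identityˡ _)
                         , (λ x → R.+-identityʳ _ , R.+-identityʳ _)
              }
            ; inverse = (λ x → R.-‿inverseˡ _ , R.-‿inverseˡ _)
                      , (λ x → R.-‿inverseʳ _ , R.-‿inverseʳ _)
            ; ⁻¹-cong = λ (p , q) → R.-‿cong p , R.-‿cong q
            }
          ; comm = λ x y → R.+-comm _ _ , R.+-comm _ _
          }
        ; *-cong = *-cong
        ; *-assoc = *-assoc
        ; *-identity = comm∧idˡ⇒id *-comm *-identityˡ
        ; distrib = comm∧distrˡ⇒distr +-cong *-comm *-distribˡ-+
        }
      ; *-comm = *-comm
      }
    }

module Matrices (R : CommutativeRing c ℓ) where
  open CommutativeRing R

  record Vector : Set c where
    constructor vector
    field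
      e₁ e₂ : Carrier
  open Vector

  record Matrix : Set c where
    constructor matrix
    field
      e₁₁ e₁₂
        e₂₁ e₂₂ : Carrier
  open Matrix

  infix 4 _≈ᵛ_ _≈ᵐ_
  infixl 7 _*ᵐ_
  infixr 7 _*ᵛ_ _·ᵛ_ _·ᵐ_
  infix 8 _ᵀ

  _≈ᵛ_ : Vector → Vector → Set ℓ
  v ≈ᵛ w = e₁ v ≈ e₁ w × e₂ v ≈ e₂ w

  0ᵛ : Vector
  0ᵛ = vector 0# 0#

  _·ᵛ_ : Carrier → Vector → Vector
  k ·ᵛ v = vector (k * e₁ v) (k * e₂ v)

  _≈ᵐ_ : Matrix → Matrix → Set ℓ
  A ≈ᵐ B = (e₁₁ A ≈ e₁₁ B × e₁₂ A ≈ e₁₂ B) × (e₂₁ A ≈ e₂₁ B × e₂₂ A ≈ e₂₂ B)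

  1ᵐ : Matrix
  1ᵐ = matrix 1# 0#
              0# 1#

  _*ᵐ_ : Matrix → Matrix → Matrix
  A *ᵐ B = matrix
    (e₁₁ A * e₁₁ B + e₁₂ A * e₂₁ B) (e₁₁ A * e₁₂ B + e₁₂ A * e₂₂ B)
    (e₂₁ A * e₁₁ B + e₂₂ A * e₂₁ B) (e₂₁ A * e₁₂ B + e₂₂ A * e₂₂ B)

  _·ᵐ_ : Carrier → Matrix → Matrix
  k ·ᵐ A = matrix (k * e₁₁ A) (k * e₁₂ A)
                  (k * e₂₁ A) (k * e₂₂ A)

  _ᵀ : Matrix → Matrix
  A ᵀ = matrix (e₁₁ A) (e₂₁ A)
               (e₁₂ A) (e₂₂ A)

  _*ᵛ_ : Matrix → Vector → Vector
  A *ᵛ v = vector (e₁₁ A * e₁ v + e₁₂ A * e₂ v) (e₂₁ A * e₁ v + e₂₂ A * e₂ v)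

  matrixMonoid : Monoid c ℓ
  matrixMonoid = record
    { Carrier = Matrix
    ; _≈_ = _≈ᵐ_
    ; _∙_ = _*ᵐ_
    ; ε = 1ᵐ
    ; isMonoid = record
      { isSemigroup = record
        { isMagma = record
          { isEquivalence = record
            { refl  = (refl′ , refl′) , (refl′ , refl′)
            ; sym   = λ ((p , q) , (r , s)) → (sym p , sym q) , (sym r , sym s)
            ; trans = λ ((p , q) , (r , s)) ((p′ , q′) , (r′ , s′)) →
                (trans p p′ , trans q q′) , (trans r r′ , trans s s′)
            }
          ; ∙-cong = λ ((p , q) , (r , s)) ((p′ , q′) , (r′ , s′)) →
                (dot-cong p q p′ r′ , dot-cong p q q′ s′)
              , (dot-cong r s p′ r′ , dot-cong r s q′ s′)
          }
        ; assoc = λ A B C →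
              (dot-assoc B _ _ _ _ , dot-assoc B _ _ _ _)
            , (dot-assoc B _ _ _ _ , dot-assoc B _ _ _ _)
        }
      ; identity =
            (λ A → (1-0 _ _ , 1-0 _ _) , (0-1 _ _ , 0-1 _ _))
          , (λ A → (1-0ʳ _ _ , 0-1ʳ _ _) , (1-0ʳ _ _ , 0-1ʳ _ _))
      }
    }
    where
    open SemiringSolver commutativeSemiring using (solve; _:=_; _:+_; _:*_)

    refl′ : ∀ {x} → x ≈ x
    refl′ = CommutativeRing.refl R

    dot-cong : ∀ {x x′ y y′ z z′ w w′} → x ≈ x′ → y ≈ y′ → z ≈ z′ → w ≈ w′ →
               x * z + y * w ≈ x′ * z′ + y′ * w′
    dot-cong p q r s = +-cong (*-cong p r) (*-cong q s)

    dot-assoc : ∀ B x y z w →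
      (x * e₁₁ B + y * e₂₁ B) * z + (x * e₁₂ B + y * e₂₂ B) * w
      ≈ x * (e₁₁ B * z + e₁₂ B * w) + y * (e₂₁ B * z + e₂₂ B * w)
    dot-assoc (matrix a b c d) x y z w =
      solve 8 (λ a b c d x y z w →
        ((x :* a :+ y :* c) :* z :+ (x :* b :+ y :* d) :* w)
        := (x :* (a :* z :+ b :* w) :+ y :* (c :* z :+ d :* w)))
        refl′ a b c d x y z w

    1-0 : ∀ x y → 1# * x + 0# * y ≈ x
    1-0 x y = trans (+-cong (*-identityˡ x) (zeroˡ y)) (+-identityʳ x)

    0-1 : ∀ x y → 0# * x + 1# * y ≈ y
    0-1 x y = trans (+-cong (zeroˡ x) (*-identityˡ y)) (+-identityˡ y)

    1-0ʳ : ∀ x y → x * 1# + y * 0# ≈ x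
    1-0ʳ x y = trans (+-cong (*-identityʳ x) (zeroʳ y)) (+-identityʳ x)

    0-1ʳ : ∀ x y → x * 0# + y * 1# ≈ y
    0-1ʳ x y = trans (+-cong (zeroʳ x) (*-identityʳ y)) (+-identityˡ y)

  Fixed : Matrix → Pred Vector ℓ
  Fixed A v = A *ᵛ v ≈ᵛ v

  -- Over a field: S has a basis consisting of a single vector.
  OneDimensional : Pred Vector ℓ → Set (c ⊔ ℓ)
  OneDimensional S =
    ∃[ v ] v ∈ S × ¬ v ≈ᵛ 0ᵛ × (∀ w → w ∈ S → ∃[ k ] w ≈ᵛ k ·ᵛ v)

  IsReflection : Matrix → Set (c ⊔ ℓ)
  IsReflection A = OneDimensional (Fixed A)

module Units (M : Monoid c ℓ) where
  open Monoid M

  record Unit : Set (c ⊔ ℓ) where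
    constructor unit
    field
      val inv  : Carrier
      inverseʳ : val ∙ inv ≈ ε
      inverseˡ : inv ∙ val ≈ ε
  open Unit public using (val; inv)
  open Unit using (inverseʳ; inverseˡ)

  unitGroup : Group (c ⊔ ℓ) ℓ
  unitGroup = record
    { Carrier = Unit
    ; _≈_ = λ x y → val x ≈ val y
    ; _∙_ = λ x y → unit (val x ∙ val y) (inv y ∙ inv x)
        (cancel (inverseʳ y) (inverseʳ x)) (cancel (inverseˡ x) (inverseˡ y))
    ; ε = unit ε ε (identityˡ ε) (identityˡ ε)
    ; _⁻¹ = λ x → unit (inv x) (val x) (inverseˡ x) (inverseʳ x)
    ; isGroup = record
      { isMonoid = record
        { isSemigroup = record
          { isMagma = record
            { isEquivalence = record
              { refl  = Monoid.refl M
              ; sym   = sym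
              ; trans = trans
              }
            ; ∙-cong = ∙-cong
            }
          ; assoc = λ x y z → assoc (val x) (val y) (val z)
          }
        ; identity = (λ x → identityˡ (val x)) , (λ x → identityʳ (val x))
        }
      ; inverse = inverseˡ , inverseʳ
      ; ⁻¹-cong = λ {x} {y} → inv-cong x y
      }
    }
    where
    open SetoidReasoning setoid

    cancel : ∀ {a b b′ a′} → b ∙ b′ ≈ ε → a ∙ a′ ≈ ε → (a ∙ b) ∙ (b′ ∙ a′) ≈ ε
    cancel {a} {b} {b′} {a′} bb′ aa′ = begin
      (a ∙ b) ∙ (b′ ∙ a′) ≈⟨ assoc a b (b′ ∙ a′) ⟩
      a ∙ (b ∙ (b′ ∙ a′)) ≈⟨ ∙-congˡ (assoc b b′ a′) ⟨
      a ∙ ((b ∙ b′) ∙ a′) ≈⟨ ∙-congˡ (∙-congʳ bb′) ⟩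
      a ∙ (ε ∙ a′)        ≈⟨ ∙-congˡ (identityˡ a′) ⟩
      a ∙ a′              ≈⟨ aa′ ⟩
      ε                   ∎

    inv-cong : ∀ x y → val x ≈ val y → inv x ≈ inv y
    inv-cong x y x≈y = begin
      inv x                   ≈⟨ identityʳ (inv x) ⟨
      inv x ∙ ε               ≈⟨ ∙-congˡ (inverseʳ y) ⟨
      inv x ∙ (val y ∙ inv y) ≈⟨ assoc (inv x) (val y) (inv y) ⟨
      (inv x ∙ val y) ∙ inv y ≈⟨ ∙-congʳ (∙-congˡ x≈y) ⟨
      (inv x ∙ val x) ∙ inv y ≈⟨ ∙-congʳ (inverseˡ x) ⟩
      ε ∙ inv y               ≈⟨ identityˡ (inv y) ⟩
      inv y                   ∎

module Factorizations (G : Group c ℓ) where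
  open Group G hiding (identity; inverse)
  open GroupProperties G using (ε⁻¹≈ε; ⁻¹-anti-homo-∙)
  open Membership setoid using () renaming (_∈_ to _∈ᵛ_)
  open VecEquality setoid using (_≋_)

  data Generated {p} (X : Pred Carrier p) : Pred Carrier (c ⊔ ℓ ⊔ p) where
    generator : ∀ {x} → x ∈ X → x ∈ Generated X
    identity  : ε ∈ Generated X
    product   : ∀ {x y} → x ∈ Generated X → y ∈ Generated X → x ∙ y ∈ Generated X
    inverse   : ∀ {x} → x ∈ Generated X → x ⁻¹ ∈ Generated X
    respects  : ∀ {x y} → x ≈ y → x ∈ Generated X → y ∈ Generated X

  ⟨_⟩ : Vec Carrier n → Pred Carrier (c ⊔ ℓ)
  ⟨ T ⟩ = Generated (_∈ᵛ T)

  ∏ : Vec Carrier n → Carrier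
  ∏ = foldr′ _∙_ ε

  -- The index i : Fin (n - 1) counts from 0, so σ i is the Hurwitz move σ_{i+1}.
  σ : Fin (pred n) → Vec Carrier n → Vec Carrier n
  σ {suc (suc n)} zero    (x ∷ y ∷ T) = y ∷ y ⁻¹ ∙ x ∙ y ∷ T
  σ {suc (suc n)} (suc i) (x ∷ T)     = x ∷ σ i T

  -- T ⇝ V: V is obtained from T by a finite sequence of Hurwitz moves.
  -- T ≃ V: one of T, V is obtained from the other in this way.
  infix 4 _⇝_ _≃_

  _⇝_ : Vec Carrier n → Vec Carrier n → Set (c ⊔ ℓ)
  T ⇝ V = ∃[ is ] foldl (flip σ) T is ≋ V

  _≃_ : Vec Carrier n → Vec Carrier n → Set (c ⊔ ℓ)
  T ≃ V = T ⇝ V ⊎ V ⇝ T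

  -- The setoid whose equality is conjugacy under the subgroup generated by X.
  conjugacy : ∀ {p} → Pred Carrier p → Setoid c (c ⊔ ℓ ⊔ p)
  conjugacy X = record
    { Carrier = Carrier
    ; _≈_ = λ x y → ∃[ h ] h ∈ Generated X × h ⁻¹ ∙ x ∙ h ≈ y
    ; isEquivalence = record
      { refl  = λ {x} → ε , identity , conj-ε x
      ; sym   = λ {x} {y} (h , h∈ , e) → h ⁻¹ , inverse h∈ , conj-⁻¹ h x y e
      ; trans = λ {x} {y} {z} (h , h∈ , e) (k , k∈ , f) →
          h ∙ k , product h∈ k∈ , conj-∙ h k x y z e f
      }
    }
    where
    open SetoidReasoning setoid

    conj-ε : ∀ x → ε ⁻¹ ∙ x ∙ ε ≈ x
    conj-ε x = begin
      ε ⁻¹ ∙ x ∙ ε ≈⟨ identityʳ (ε ⁻¹ ∙ x) ⟩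
      ε ⁻¹ ∙ x     ≈⟨ ∙-congʳ ε⁻¹≈ε ⟩
      ε ∙ x        ≈⟨ identityˡ x ⟩
      x            ∎

    conj-∙ : ∀ h k x y z → h ⁻¹ ∙ x ∙ h ≈ y → k ⁻¹ ∙ y ∙ k ≈ z →
             (h ∙ k) ⁻¹ ∙ x ∙ (h ∙ k) ≈ z
    conj-∙ h k x y z e f = begin
      (h ∙ k) ⁻¹ ∙ x ∙ (h ∙ k)     ≈⟨ ∙-congʳ (∙-congʳ (⁻¹-anti-homo-∙ h k)) ⟩
      k ⁻¹ ∙ h ⁻¹ ∙ x ∙ (h ∙ k)    ≈⟨ assoc _ h k ⟨
      k ⁻¹ ∙ h ⁻¹ ∙ x ∙ h ∙ k      ≈⟨ ∙-congʳ (∙-congʳ (assoc _ _ _)) ⟩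
      k ⁻¹ ∙ (h ⁻¹ ∙ x) ∙ h ∙ k    ≈⟨ ∙-congʳ (assoc _ _ _) ⟩
      k ⁻¹ ∙ (h ⁻¹ ∙ x ∙ h) ∙ k    ≈⟨ ∙-congʳ (∙-congˡ e) ⟩
      k ⁻¹ ∙ y ∙ k                 ≈⟨ f ⟩
      z                            ∎

    conj-⁻¹ : ∀ h x y → h ⁻¹ ∙ x ∙ h ≈ y → (h ⁻¹) ⁻¹ ∙ y ∙ h ⁻¹ ≈ x
    conj-⁻¹ h x y e = begin
      (h ⁻¹) ⁻¹ ∙ y ∙ h ⁻¹         ≈⟨ conj-∙ h (h ⁻¹) x y _ e (Group.refl G) ⟨
      (h ∙ h ⁻¹) ⁻¹ ∙ x ∙ (h ∙ h ⁻¹)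
        ≈⟨ ∙-cong (∙-congʳ (⁻¹-cong (inverseʳ h))) (inverseʳ h) ⟩
      ε ⁻¹ ∙ x ∙ ε                 ≈⟨ conj-ε x ⟩
      x                            ∎

  -- The multisets of ⟨ T ⟩-conjugacy classes of the entries of T and of V agree:
  -- multisets over a setoid are lists up to permutation and setoid equality.
  SameClasses : Vec Carrier n → Vec Carrier n → Set (c ⊔ ℓ)
  SameClasses T V = toList T ↭ toList V
    where open Permutation (conjugacy (_∈ᵛ T)) using (_↭_)

-- K = ℚ(√3, i), a subfield of ℂ containing the matrix entries below.  Kernels of
-- matrices over K have the same dimension over K as over ℂ, so it does not matter
-- over which of the two fields a reflection is defined.
module ℚ[√3] = QuadraticExtension ℚ.+-*-commutativeRing (+ 3 / 1)
module ℚ[√3,i] = QuadraticExtension ℚ[√3].commutativeRing (ℚ[√3].embed (-[1+ 0 ] / 1))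

K : CommutativeRing 0ℓ 0ℓ
K = ℚ[√3,i].commutativeRing

open CommutativeRing K using (_+_; _-_; -_; _*_; 0#; 1#)
open Matrices K public
open Units matrixMonoid public

GL₂ : Group 0ℓ 0ℓ
GL₂ = unitGroup

open Group GL₂ public using () renaming (Carrier to ∣GL₂∣)
open Factorizations GL₂ public

√3 i ¼ : CommutativeRing.Carrier K
√3 = ℚ[√3,i].embed ℚ[√3].√d
i  = ℚ[√3,i].√d
¼  = ℚ[√3,i].embed (ℚ[√3].embed (+ 1 / 4))

sᵐ tᵐ : Matrix
sᵐ = matrix 1# 0#
            0# (- 1#)
tᵐ = ¼ ·ᵐ matrix ((1# + √3) + (- 1# + √3) * i) ((1# + √3) + (- 1# + √3) * i)
                 ((- 1# + √3) - (1# + √3) * i) ((1# - √3) + (1# + √3) * i)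

private
  pattern coordinatewise = (refl , refl) , (refl , refl)
  pattern entrywise =
    (coordinatewise , coordinatewise) , (coordinatewise , coordinatewise)

-- Inverses come from s² = t³ = u³ = 1.
s t u : ∣GL₂∣
s = unit sᵐ sᵐ entrywise entrywise
t = unit tᵐ (tᵐ *ᵐ tᵐ) entrywise entrywise
u = unit (tᵐ ᵀ) (tᵐ ᵀ *ᵐ tᵐ ᵀ) entrywise entrywise

G₇ : Pred ∣GL₂∣ 0ℓ
G₇ = ⟨ s ∷ t ∷ u ∷ [] ⟩

-- T is a reflection factorization of the element ∏ T.
IsReflectionFactorizationIn : Pred ∣GL₂∣ 0ℓ → Vec ∣GL₂∣ n → Set
IsReflectionFactorizationIn H = All (λ r → IsReflection (val r) × r ∈ H)

{-# OPTIONS --safe #-}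

-- Hurwitz moves preserve the product, the generated subgroup H and the multiset of H-classes.
-- For the converse, the 22 reflections are labelled by the edges of a tetrahedron (order 2) and
-- by pairs of a class and a vertex (order 3); conjugation factors through the rotation group of
-- the tetrahedron, so the Hurwitz moves act on words in the labels.  Two reflections commute iff
-- they lie on a common axis.  If all entries of T lie on one axis, Hurwitz moves are plain
-- transpositions and the classes are the entries themselves.  Otherwise T and V are compared by
-- moving one and the same letter to the front of both and cancelling it: if some triple of letters
-- allows this it allows it in every longer word, so only words of length at most four have to be
-- inspected.  Which letter to strip is read off from the multiset of axes (all entries of order 2)
-- or of classes (otherwise).  For words in reflections of order 3 alone, of length at least four,
-- all but at most one of the four conjugates in a class can be moved to the front without making
-- the rest commute, so two such words have a suitable first letter in common.

module Submission where

open import Defs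
  using (module QuadraticExtension; module Matrices; module Units; module Factorizations)
open import Algebra.Bundles using (CommutativeRing; Monoid; Group)
import Algebra.Properties.CommutativeSemigroup as CommutativeSemigroupProperties
import Algebra.Properties.Group as GroupProperties
import Algebra.Properties.Ring as RingProperties
import Algebra.Solver.Ring.NaturalCoefficients.Default as SemiringSolver
open import Data.Empty using (⊥)
open import Data.Fin.Base using (Fin; zero; suc; toℕ; _↑ˡ_)
open import Data.Fin.Patterns
import Data.Fin.Properties as Fin
open import Data.Integer.Base as ℤ using (ℤ; +_; -[1+_]; 0ℤ; -1ℤ)
import Data.Integer.Properties as ℤ
open import Data.List.Base using (List; []; _∷_; foldl; foldr; map; _++_; length)
import Data.List.Membership.Propositional as List
open import Data.List.Membership.Propositional.Properties using (∈-map⁻; ∈-∃++)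
open import Data.List.Properties using (map-id; map-∘; map-cong; foldl-++)
import Data.List.Relation.Binary.Permutation.Homogeneous as Homogeneous
open import Data.List.Relation.Binary.Permutation.Propositional as Permutation
  using (_↭_; ↭-refl; ↭-sym; ↭-trans; ↭-reflexive; prep)
open import Data.List.Relation.Binary.Permutation.Propositional.Properties
  using (∈-resp-↭; All-resp-↭; ↭-length; ↭-empty-inv; drop-∷; shift)
open import Data.List.Relation.Binary.Pointwise.Base using (Pointwise; []; _∷_)
open import Data.List.Relation.Unary.All as All using (All; []; _∷_; all?)
import Data.List.Relation.Unary.All.Properties as All
open import Data.List.Relation.Unary.Any as Any using (Any; here; there; any?)
open import Data.Maybe.Base using (Maybe; just; nothing)
open import Data.Nat.Base using (ℕ; zero; suc; pred)
open import Data.Product.Base using (_×_; _,_; ∃-syntax; proj₁; proj₂)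
import Data.Product.Properties as ×
open import Data.Rational.Base as ℚ using (ℚ)
open import Data.Rational.Literals using (fromℤ)
import Data.Rational.Properties as ℚ
import Data.Rational.Unnormalised.Base as ℚᵘ
import Data.Rational.Unnormalised.Properties as ℚᵘ
open import Data.Sum.Base as Sum using (_⊎_; inj₁; inj₂; [_,_]′)
import Data.Sum.Properties as ⊎
open import Data.Unit.Base using (⊤; tt)
open import Data.Vec.Base using (Vec; lookup; toList; []; _∷_)
import Data.Vec.Membership.Setoid as Membership
import Data.Vec.Relation.Binary.Equality.Setoid as VecEquality
open import Data.Vec.Relation.Unary.All using ([]; _∷_)
import Data.Vec.Relation.Unary.Any as Vec
open import Function.Base using (id; flip; _∘_)
open import Function.Bundles using (_⇔_; mk⇔)
open import Level using (0ℓ)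
open import Relation.Binary.Bundles using (Setoid)
open import Relation.Binary.Definitions using (Decidable)
open import Relation.Binary.PropositionalEquality as ≡
  using (_≡_; _≢_; refl; cong; cong₂; sym; trans; subst; subst₂)
import Relation.Binary.Reasoning.Setoid as SetoidReasoning
open import Relation.Nullary.Decidable using (Dec; yes; no; toWitness; _×-dec_; _⊎-dec_; ¬?; map′)
open import Relation.Nullary.Negation using (¬_; contradiction)
open import Relation.Unary using (Pred; _∈_; _⊆_; _≐_)

-- Matrices over embedded rings

record Embedding (R S : CommutativeRing 0ℓ 0ℓ) : Set where
  private
    module R = CommutativeRing R
    module S = CommutativeRing S
  field
    ⟦_⟧       : R.Carrier → S.Carrier
    ⟦⟧-cong   : ∀ {x y} → x R.≈ y → ⟦ x ⟧ S.≈ ⟦ y ⟧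
    +-homo    : ∀ x y → ⟦ x R.+ y ⟧ S.≈ ⟦ x ⟧ S.+ ⟦ y ⟧
    *-homo    : ∀ x y → ⟦ x R.* y ⟧ S.≈ ⟦ x ⟧ S.* ⟦ y ⟧
    0-homo    : ⟦ R.0# ⟧ S.≈ S.0#
    1-homo    : ⟦ R.1# ⟧ S.≈ S.1#
    injective : ∀ {x y} → ⟦ x ⟧ S.≈ ⟦ y ⟧ → x R.≈ y

adjoin : ∀ {R S} (f : Embedding R S) {d d′} → CommutativeRing._≈_ S (Embedding.⟦_⟧ f d) d′ →
         Embedding (QuadraticExtension.commutativeRing R d) (QuadraticExtension.commutativeRing S d′)
adjoin {R} {S} f {d} {d′} d≈ = record
  { ⟦_⟧       = λ x → ⟦ E.base x ⟧ F.⊕ ⟦ E.surd x ⟧ √d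
  ; ⟦⟧-cong   = λ (p , q) → ⟦⟧-cong p , ⟦⟧-cong q
  ; +-homo    = λ _ _ → +-homo _ _ , +-homo _ _
  ; *-homo    = λ _ _ →
        S.trans (+-homo _ _) (S.+-cong (*-homo _ _)
          (S.trans (*-homo _ _) (S.*-cong d≈ (*-homo _ _))))
      , S.trans (+-homo _ _) (S.+-cong (*-homo _ _) (*-homo _ _))
  ; 0-homo    = 0-homo , 0-homo
  ; 1-homo    = 1-homo , 0-homo
  ; injective = λ (p , q) → injective p , injective q
  }
  where
  open Embedding f
  module S = CommutativeRing S
  module E = QuadraticExtension R d
  module F = QuadraticExtension S d′

embed-inverse : ∀ (R : CommutativeRing 0ℓ 0ℓ) d {x y} →
                let open CommutativeRing R; module E = QuadraticExtension R d in
                x * y ≈ 1# → E.embed x E.* E.embed y E.≈ E.embed 1#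
embed-inverse R d {x} {y} xy =
    ≈-trans (+-cong xy (≈-trans (*-congˡ (zeroʳ 0#)) (zeroʳ d))) (+-identityʳ 1#)
  , ≈-trans (+-cong (zeroʳ x) (zeroˡ y)) (+-identityʳ 0#)
  where open CommutativeRing R renaming (trans to ≈-trans)

module MatrixProperties (R : CommutativeRing 0ℓ 0ℓ) where
  open CommutativeRing R renaming (refl to ≈-refl; sym to ≈-sym; trans to ≈-trans)
  open Matrices R
  open Monoid matrixMonoid public using ()
    renaming (setoid to ≈ᵐ-setoid; refl to ≈ᵐ-refl; sym to ≈ᵐ-sym; trans to ≈ᵐ-trans; ∙-cong to *ᵐ-cong)
  open SemiringSolver commutativeSemiring using (solve; _:=_; _:+_; _:*_)

  ·ᵐ-cong : ∀ {x y A B} → x ≈ y → A ≈ᵐ B → x ·ᵐ A ≈ᵐ y ·ᵐ B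
  ·ᵐ-cong e ((p , q) , (r , s)) = (*-cong e p , *-cong e q) , (*-cong e r , *-cong e s)

  ·ᵐ-assoc : ∀ x y A → (x * y) ·ᵐ A ≈ᵐ x ·ᵐ y ·ᵐ A
  ·ᵐ-assoc x y A = (*-assoc _ _ _ , *-assoc _ _ _) , (*-assoc _ _ _ , *-assoc _ _ _)

  ·ᵐ-identity : ∀ A → 1# ·ᵐ A ≈ᵐ A
  ·ᵐ-identity A = (*-identityˡ _ , *-identityˡ _) , (*-identityˡ _ , *-identityˡ _)

  ·ᵐ-*ᵐ : ∀ x y A B → (x ·ᵐ A) *ᵐ (y ·ᵐ B) ≈ᵐ (x * y) ·ᵐ (A *ᵐ B)
  ·ᵐ-*ᵐ x y A B = (dot , dot) , (dot , dot)
    where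
    dot : ∀ {a b c d} → x * a * (y * b) + x * c * (y * d) ≈ x * y * (a * b + c * d)
    dot {a} {b} {c} {d} = solve 6 (λ x y a b c d →
      x :* a :* (y :* b) :+ x :* c :* (y :* d) := x :* y :* (a :* b :+ c :* d)) ≈-refl x y a b c d

  ·ᵐ-*ᵐˡ : ∀ x A B → (x ·ᵐ A) *ᵐ B ≈ᵐ x ·ᵐ (A *ᵐ B)
  ·ᵐ-*ᵐˡ x A B = (dot , dot) , (dot , dot)
    where
    dot : ∀ {a b c d} → x * a * b + x * c * d ≈ x * (a * b + c * d)
    dot {a} {b} {c} {d} = solve 5 (λ x a b c d →
      x :* a :* b :+ x :* c :* d := x :* (a :* b :+ c :* d)) ≈-refl x a b c d

  ·ᵐ-cancel : ∀ {x y A B} → y * x ≈ 1# → x ·ᵐ A ≈ᵐ x ·ᵐ B → A ≈ᵐ B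
  ·ᵐ-cancel {x} {y} {A} {B} yx e = begin
    A              ≈⟨ undo A ⟨
    y ·ᵐ x ·ᵐ A    ≈⟨ ·ᵐ-cong ≈-refl e ⟩
    y ·ᵐ x ·ᵐ B    ≈⟨ undo B ⟩
    B              ∎
    where
    open SetoidReasoning ≈ᵐ-setoid
    undo : ∀ C → y ·ᵐ x ·ᵐ C ≈ᵐ C
    undo C = begin
      y ·ᵐ x ·ᵐ C   ≈⟨ ·ᵐ-assoc y x C ⟨
      (y * x) ·ᵐ C  ≈⟨ ·ᵐ-cong yx ≈ᵐ-refl ⟩
      1# ·ᵐ C       ≈⟨ ·ᵐ-identity C ⟩
      C             ∎

  -- e is the determinant of matrix a b c d, presented without subtraction.
  kernel-trivial : ∀ {a b c d e r v w} → a * d ≈ e + b * c → r * e ≈ 1# →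
                   a * v + b * w ≈ 0# → c * v + d * w ≈ 0# → v ≈ 0# × w ≈ 0#
  kernel-trivial {a} {b} {c} {d} {e} {r} {v} {w} ad re row₁ row₂ = cancel ev , cancel ew
    where
    open SetoidReasoning setoid
    cancel : ∀ {x} → e * x ≈ 0# → x ≈ 0#
    cancel {x} ex = begin
      x            ≈⟨ *-identityˡ x ⟨
      1# * x       ≈⟨ *-congʳ re ⟨
      r * e * x    ≈⟨ *-assoc r e x ⟩
      r * (e * x)  ≈⟨ *-congˡ ex ⟩
      r * 0#       ≈⟨ zeroʳ r ⟩
      0#           ∎
    drop : ∀ {x y z} → y ≈ 0# → x + y ≈ z → z ≈ 0# → x ≈ 0#
    drop y e z = ≈-trans (≈-sym (+-identityʳ _)) (≈-trans (+-congˡ (≈-sym y)) (≈-trans e z))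
    -- Cramer's rule without subtraction: `d` times the first row equals `e * v` plus `b` times the
    -- second row.
    ev : e * v ≈ 0#
    ev = drop row₂′ (begin
      e * v + b * (c * v + d * w)
        ≈⟨ solve 6 (λ e b c d v w →
           e :* v :+ b :* (c :* v :+ d :* w) := (e :+ b :* c) :* v :+ d :* (b :* w))
           ≈-refl e b c d v w ⟩
      (e + b * c) * v + d * (b * w)      ≈⟨ +-congʳ (*-congʳ ad) ⟨
      a * d * v + d * (b * w)
        ≈⟨ solve 5 (λ a b d v w →
           a :* d :* v :+ d :* (b :* w) := d :* (a :* v :+ b :* w))
           ≈-refl a b d v w ⟩
      d * (a * v + b * w)                ∎) (≈-trans (*-congˡ row₁) (zeroʳ d))
      where row₂′ = ≈-trans (*-congˡ row₂) (zeroʳ b)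
    ew : e * w ≈ 0#
    ew = drop row₁′ (begin
      e * w + c * (a * v + b * w)
        ≈⟨ solve 6 (λ e a b c v w →
           e :* w :+ c :* (a :* v :+ b :* w) := (e :+ b :* c) :* w :+ a :* (c :* v))
           ≈-refl e a b c v w ⟩
      (e + b * c) * w + a * (c * v)      ≈⟨ +-congʳ (*-congʳ ad) ⟨
      a * d * w + a * (c * v)
        ≈⟨ solve 5 (λ a c d v w →
           a :* d :* w :+ a :* (c :* v) := a :* (c :* v :+ d :* w))
           ≈-refl a c d v w ⟩
      a * (c * v + d * w)                ∎) (≈-trans (*-congˡ row₂) (zeroʳ a))
      where row₁′ = ≈-trans (*-congˡ row₁) (zeroʳ c)

  -- Both basis vectors are fixed. If both were multiples of one `v`, the product of the diagonal
  -- entries of `1ᵐ` would equal that of the off-diagonal ones.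
  1ᵐ-not-reflection : IsReflection 1ᵐ → 1# ≈ 0#
  1ᵐ-not-reflection (v , _ , _ , multiple)
    with multiple (vector 1# 0#) (fixed _) | multiple (vector 0# 1#) (fixed _)
    where
    fixed : ∀ w → 1ᵐ *ᵛ w ≈ᵛ w
    fixed w = ≈-trans (+-cong (*-identityˡ _) (zeroˡ _)) (+-identityʳ _)
            , ≈-trans (+-cong (zeroˡ _) (*-identityˡ _)) (+-identityˡ _)
  ... | k , 1≈kx , 0≈ky | l , 0≈lx , 1≈ly = begin
    1#                             ≈⟨ *-identityˡ 1# ⟨
    1# * 1#                        ≈⟨ *-cong 1≈kx 1≈ly ⟩
    k * Vector.e₁ v * (l * Vector.e₂ v)
      ≈⟨ solve 4 (λ k l x y →
         k :* x :* (l :* y) := (l :* x) :* (k :* y))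
         ≈-refl k l _ _ ⟩
    l * Vector.e₁ v * (k * Vector.e₂ v)  ≈⟨ *-cong 0≈lx 0≈ky ⟨
    0# * 0#                        ≈⟨ zeroˡ 0# ⟩
    0#                             ∎
    where open SetoidReasoning setoid


  -- Multiplying by `n`, the inverse of `x`, turns a fixed vector of `x ·ᵐ A` into a kernel vector
  -- of `A` minus `n`, whose diagonal entries are `a′` and `d′` and whose determinant `e` is a unit.
  fixed⇒zero : ∀ {x n a′ d′ e r A v} → n * x ≈ 1# →
    Matrix.e₁₁ A ≈ a′ + n → Matrix.e₂₂ A ≈ d′ + n →
    a′ * d′ ≈ e + Matrix.e₁₂ A * Matrix.e₂₁ A → r * e ≈ 1# → Fixed (x ·ᵐ A) v → v ≈ᵛ 0ᵛ
  fixed⇒zero {x} {n} {a′} {d′} {e} {r} {matrix a b c d} {vector v w} nx a≈ d≈ ad re (fix₁ , fix₂) =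
    kernel-trivial ad re
      (+-cancelʳ _ _ _ (begin
        a′ * v + b * w + n * v
          ≈⟨ solve 5 (λ a b n v w →
             a :* v :+ b :* w :+ n :* v := (a :+ n) :* v :+ b :* w)
             ≈-refl a′ b n v w ⟩
        (a′ + n) * v + b * w         ≈⟨ +-congʳ (*-congʳ a≈) ⟨
        a * v + b * w                ≈⟨ unscale fix₁ ⟩
        n * v                        ≈⟨ +-identityˡ _ ⟨
        0# + n * v                   ∎))
      (+-cancelʳ _ _ _ (begin
        c * v + d′ * w + n * w
          ≈⟨ solve 5 (λ c d n v w →
             c :* v :+ d :* w :+ n :* w := c :* v :+ (d :+ n) :* w)
             ≈-refl c d′ n v w ⟩
        c * v + (d′ + n) * w         ≈⟨ +-congˡ (*-congʳ d≈) ⟨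
        c * v + d * w                ≈⟨ unscale fix₂ ⟩
        n * w                        ≈⟨ +-identityˡ _ ⟨
        0# + n * w                   ∎))
    where
    open SetoidReasoning setoid
    open RingProperties ring using (+-cancelʳ)
    unscale : ∀ {p q y} → x * p * v + x * q * w ≈ y → p * v + q * w ≈ n * y
    unscale {p} {q} {y} fix = begin
      p * v + q * w                   ≈⟨ *-identityˡ _ ⟨
      1# * (p * v + q * w)            ≈⟨ *-congʳ nx ⟨
      n * x * (p * v + q * w)
        ≈⟨ solve 6 (λ n x p q v w →
           n :* x :* (p :* v :+ q :* w) := n :* (x :* p :* v :+ x :* q :* w))
           ≈-refl n x p q v w ⟩
      n * (x * p * v + x * q * w)     ≈⟨ *-congˡ fix ⟩
      n * y                           ∎

module MatrixEmbedding {R S : CommutativeRing 0ℓ 0ℓ} (f : Embedding R S) where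
  private
    module R = CommutativeRing R
    module S = CommutativeRing S
    module MR where
      open Matrices R public
      open MatrixProperties R public
    module MS where
      open Matrices S public
      open MatrixProperties S public
  open Embedding f

  ⟦_⟧ᵐ : MR.Matrix → MS.Matrix
  ⟦ MR.matrix a b c d ⟧ᵐ = MS.matrix ⟦ a ⟧ ⟦ b ⟧ ⟦ c ⟧ ⟦ d ⟧

  ⟦⟧ᵐ-cong : ∀ {A B} → A MR.≈ᵐ B → ⟦ A ⟧ᵐ MS.≈ᵐ ⟦ B ⟧ᵐ
  ⟦⟧ᵐ-cong ((p , q) , (r , s)) = (⟦⟧-cong p , ⟦⟧-cong q) , (⟦⟧-cong r , ⟦⟧-cong s)

  ⟦⟧ᵐ-injective : ∀ {A B} → ⟦ A ⟧ᵐ MS.≈ᵐ ⟦ B ⟧ᵐ → A MR.≈ᵐ B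
  ⟦⟧ᵐ-injective ((p , q) , (r , s)) = (injective p , injective q) , (injective r , injective s)

  *ᵐ-homo : ∀ A B → ⟦ A MR.*ᵐ B ⟧ᵐ MS.≈ᵐ ⟦ A ⟧ᵐ MS.*ᵐ ⟦ B ⟧ᵐ
  *ᵐ-homo A B = (dot , dot) , (dot , dot)
    where
    dot : ∀ {x y z w} → ⟦ x R.* y R.+ z R.* w ⟧ S.≈ ⟦ x ⟧ S.* ⟦ y ⟧ S.+ ⟦ z ⟧ S.* ⟦ w ⟧
    dot = S.trans (+-homo _ _) (S.+-cong (*-homo _ _) (*-homo _ _))

  ·ᵐ-homo : ∀ x A → ⟦ x MR.·ᵐ A ⟧ᵐ MS.≈ᵐ ⟦ x ⟧ MS.·ᵐ ⟦ A ⟧ᵐ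
  ·ᵐ-homo x A = (*-homo _ _ , *-homo _ _) , (*-homo _ _ , *-homo _ _)

  1ᵐ-homo : ⟦ MR.1ᵐ ⟧ᵐ MS.≈ᵐ MS.1ᵐ
  1ᵐ-homo = (1-homo , 0-homo) , (0-homo , 1-homo)

  scale : S.Carrier → MR.Matrix → MS.Matrix
  scale x A = x MS.·ᵐ ⟦ A ⟧ᵐ

  scale-cong : ∀ x {A B} → A MR.≈ᵐ B → scale x A MS.≈ᵐ scale x B
  scale-cong x A≈B = MS.·ᵐ-cong S.refl (⟦⟧ᵐ-cong A≈B)

  scale-*ᵐ : ∀ x y A B → scale x A MS.*ᵐ scale y B MS.≈ᵐ scale (x S.* y) (A MR.*ᵐ B)
  scale-*ᵐ x y A B = MS.≈ᵐ-trans (MS.·ᵐ-*ᵐ x y _ _) (MS.·ᵐ-cong S.refl (MS.≈ᵐ-sym (*ᵐ-homo A B)))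

  scale-reduce : ∀ x {y n} A → y S.* ⟦ n ⟧ S.≈ S.1# → scale (x S.* y) (n MR.·ᵐ A) MS.≈ᵐ scale x A
  scale-reduce x {y} {n} A yn = begin
    (x S.* y) MS.·ᵐ ⟦ n MR.·ᵐ A ⟧ᵐ         ≈⟨ MS.·ᵐ-cong S.refl (·ᵐ-homo n A) ⟩
    (x S.* y) MS.·ᵐ ⟦ n ⟧ MS.·ᵐ ⟦ A ⟧ᵐ     ≈⟨ MS.·ᵐ-assoc _ _ _ ⟨
    (x S.* y S.* ⟦ n ⟧) MS.·ᵐ ⟦ A ⟧ᵐ       ≈⟨ MS.·ᵐ-cong xyn≈x MS.≈ᵐ-refl ⟩
    x MS.·ᵐ ⟦ A ⟧ᵐ                         ∎
    where
    open SetoidReasoning MS.≈ᵐ-setoid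
    xyn≈x : x S.* y S.* ⟦ n ⟧ S.≈ x
    xyn≈x = S.trans (S.*-assoc _ _ _) (S.trans (S.*-congˡ yn) (S.*-identityʳ x))

  scale-injective : ∀ {x y A B} → y S.* x S.≈ S.1# → scale x A MS.≈ᵐ scale x B → A MR.≈ᵐ B
  scale-injective yx e = ⟦⟧ᵐ-injective (MS.·ᵐ-cancel yx e)

-- Group elements as matrices with a fixed denominator

module ScaledRepresentation
  {R S : CommutativeRing 0ℓ 0ℓ} (f : Embedding R S)
  (n : CommutativeRing.Carrier R) (x : CommutativeRing.Carrier S)
  (xn≈1 : CommutativeRing._≈_ S (CommutativeRing._*_ S x (Embedding.⟦_⟧ f n)) (CommutativeRing.1# S))
  where
  private
    module R = CommutativeRing R
    module S = CommutativeRing S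
    module MR where
      open Matrices R public
      open MatrixProperties R public
    module MS where
      open Matrices S public
      open MatrixProperties S public
  open Embedding f
  open MatrixEmbedding f
  open CommutativeSemigroupProperties S.*-commutativeSemigroup using (interchange)

  scalar : R.Carrier → MR.Matrix
  scalar r = r MR.·ᵐ MR.1ᵐ

  nx≈1 : ⟦ n ⟧ S.* x S.≈ S.1#
  nx≈1 = S.trans (S.*-comm _ _) xn≈1

  *-inverse : ∀ {y y′ z z′} → y S.* z S.≈ S.1# → y′ S.* z′ S.≈ S.1# → y S.* y′ S.* (z S.* z′) S.≈ S.1#
  *-inverse yz yz′ = S.trans (interchange _ _ _ _) (S.trans (S.*-cong yz yz′) (S.*-identityˡ _))

  scale-*ᵐ-reduce : ∀ {A B C} → A MR.*ᵐ B MR.≈ᵐ n MR.·ᵐ C → scale x A MS.*ᵐ scale x B MS.≈ᵐ scale x C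
  scale-*ᵐ-reduce {A} {B} {C} e =
    MS.≈ᵐ-trans (scale-*ᵐ x x A B) (MS.≈ᵐ-trans (scale-cong _ e) (scale-reduce x C xn≈1))

  scale-scalar : scale x (scalar n) MS.≈ᵐ MS.1ᵐ
  scale-scalar = begin
    x MS.·ᵐ ⟦ n MR.·ᵐ MR.1ᵐ ⟧ᵐ      ≈⟨ MS.·ᵐ-cong S.refl (·ᵐ-homo n MR.1ᵐ) ⟩
    x MS.·ᵐ ⟦ n ⟧ MS.·ᵐ ⟦ MR.1ᵐ ⟧ᵐ  ≈⟨ MS.·ᵐ-assoc _ _ _ ⟨
    (x S.* ⟦ n ⟧) MS.·ᵐ ⟦ MR.1ᵐ ⟧ᵐ  ≈⟨ MS.·ᵐ-cong xn≈1 1ᵐ-homo ⟩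
    S.1# MS.·ᵐ MS.1ᵐ                ≈⟨ MS.·ᵐ-identity _ ⟩
    MS.1ᵐ                           ∎
    where open SetoidReasoning MS.≈ᵐ-setoid

  open Units MS.matrixMonoid
  private module G = Group unitGroup

  module _ {a} {L : Set a} (Λ : L → MR.Matrix) (opposite : L → L)
    (inverses : ∀ l → Λ l MR.*ᵐ Λ (opposite l) MR.≈ᵐ n MR.·ᵐ scalar n ×
                      Λ (opposite l) MR.*ᵐ Λ l MR.≈ᵐ n MR.·ᵐ scalar n) where

    represent : L → Unit
    represent l = unit (scale x (Λ l)) (scale x (Λ (opposite l)))
      (MS.≈ᵐ-trans (scale-*ᵐ-reduce (proj₁ (inverses l))) scale-scalar)
      (MS.≈ᵐ-trans (scale-*ᵐ-reduce (proj₂ (inverses l))) scale-scalar)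

    represent-injective : ∀ {k l} → represent k G.≈ represent l → Λ k MR.≈ᵐ Λ l
    represent-injective = scale-injective nx≈1

    represent-pair : ∀ {k l k′ l′} → Λ k MR.*ᵐ Λ l MR.≈ᵐ Λ k′ MR.*ᵐ Λ l′ →
                     represent k G.∙ represent l G.≈ represent k′ G.∙ represent l′
    represent-pair e = MS.≈ᵐ-trans (scale-*ᵐ x x _ _)
      (MS.≈ᵐ-trans (scale-cong _ e) (MS.≈ᵐ-sym (scale-*ᵐ x x _ _)))

    -- Both sides carry the same denominator, so it cancels: an equation between units descends to
    -- matrices over `R`, where a computation can refute it.
    represent-pair⁻ : ∀ {k l k′ l′} → represent k G.∙ represent l G.≈ represent k′ G.∙ represent l′ →
                      Λ k MR.*ᵐ Λ l MR.≈ᵐ Λ k′ MR.*ᵐ Λ l′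
    represent-pair⁻ e = scale-injective (*-inverse nx≈1 nx≈1)
      (MS.≈ᵐ-trans (MS.≈ᵐ-sym (scale-*ᵐ x x _ _)) (MS.≈ᵐ-trans e (scale-*ᵐ x x _ _)))

    represent-triple⁻ : ∀ {k l m k′ l′ m′} →
      represent k G.∙ (represent l G.∙ represent m) G.≈ represent k′ G.∙ (represent l′ G.∙ represent m′) →
      Λ k MR.*ᵐ (Λ l MR.*ᵐ Λ m) MR.≈ᵐ Λ k′ MR.*ᵐ (Λ l′ MR.*ᵐ Λ m′)
    represent-triple⁻ {k} {l} {m} {k′} {l′} {m′} e =
      scale-injective (*-inverse nx≈1 (*-inverse nx≈1 nx≈1))
        (MS.≈ᵐ-trans (MS.≈ᵐ-sym (expand k l m)) (MS.≈ᵐ-trans e (expand k′ l′ m′)))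
      where
      expand : ∀ k l m → scale x (Λ k) MS.*ᵐ (scale x (Λ l) MS.*ᵐ scale x (Λ m)) MS.≈ᵐ
                         scale (x S.* (x S.* x)) (Λ k MR.*ᵐ (Λ l MR.*ᵐ Λ m))
      expand k l m = MS.≈ᵐ-trans (MS.*ᵐ-cong MS.≈ᵐ-refl (scale-*ᵐ x x _ _)) (scale-*ᵐ x _ _ _)

  -- Enumerating a generated group and finding its reflections

  module Elements {j q} {J : Set j} {Q : Set q} (root : J → R.Carrier) (core : Q → MR.Matrix)
    (root-* : ∀ i j → ∃[ k ] root i R.* root j R.≈ n R.* root k) where

    element : J → Q → MR.Matrix
    element j q = root j MR.·ᵐ core q

    -- `root j` and `core q` each carry a factor `n`, hence the two factors `x`.
    Element : Pred MS.Matrix _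
    Element A = ∃[ j ] ∃[ q ] A MS.≈ᵐ scale (x S.* x) (element j q)

    -- Closure under right multiplication by the generators and their inverses bounds the whole
    -- generated group, once `1ᵐ` is an `Element`.
    Preserving : Pred MS.Matrix _
    Preserving B = ∀ {A} → Element A → Element (A MS.*ᵐ B)

    preserving-scale : ∀ {B} → (∀ q → ∃[ j ] ∃[ q′ ] core q MR.*ᵐ B MR.≈ᵐ root j MR.·ᵐ core q′) →
                       Preserving (scale x B)
    preserving-scale {B} step {A} (i , q , A≈) with step q
    ... | j , q′ , qB with root-* i j
    ...   | k , ij = k , q′ , (begin
      A MS.*ᵐ scale x B                                        ≈⟨ MS.*ᵐ-cong A≈ MS.≈ᵐ-refl ⟩
      scale (x S.* x) (root i MR.·ᵐ core q) MS.*ᵐ scale x B    ≈⟨ scale-*ᵐ _ x _ _ ⟩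
      scale (x S.* x S.* x) ((root i MR.·ᵐ core q) MR.*ᵐ B)    ≈⟨ scale-cong _ collect ⟩
      scale (x S.* x S.* x) (n MR.·ᵐ (root k MR.·ᵐ core q′))   ≈⟨ scale-reduce _ _ xn≈1 ⟩
      scale (x S.* x) (root k MR.·ᵐ core q′)                   ∎)
      where
      open SetoidReasoning MS.≈ᵐ-setoid
      collect : (root i MR.·ᵐ core q) MR.*ᵐ B MR.≈ᵐ n MR.·ᵐ (root k MR.·ᵐ core q′)
      collect = MR.≈ᵐ-trans (MR.·ᵐ-*ᵐˡ _ _ _) (MR.≈ᵐ-trans (MR.·ᵐ-cong R.refl qB)
        (MR.≈ᵐ-trans (MR.≈ᵐ-sym (MR.·ᵐ-assoc _ _ _)) (MR.≈ᵐ-trans (MR.·ᵐ-cong ij MR.≈ᵐ-refl) (MR.·ᵐ-assoc _ _ _))))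

    preserving-* : ∀ {B C} → Preserving B → Preserving C → Preserving (B MS.*ᵐ C)
    preserving-* {B} {C} b c {A} a with c (b a)
    ... | j , q , e = j , q , MS.≈ᵐ-trans (MS.≈ᵐ-sym (assoc A B C)) e
      where open Monoid MS.matrixMonoid using (assoc)

    preserving-≈ : ∀ {B C} → B MS.≈ᵐ C → Preserving B → Preserving C
    preserving-≈ B≈C b a with b a
    ... | j , q , e = j , q , MS.≈ᵐ-trans (MS.*ᵐ-cong MS.≈ᵐ-refl (MS.≈ᵐ-sym B≈C)) e

    preserving-1 : Preserving MS.1ᵐ
    preserving-1 {A} (j , q , e) = j , q , MS.≈ᵐ-trans (identityʳ A) e
      where open Monoid MS.matrixMonoid using (identityʳ)

    open Factorizations unitGroup using (Generated; generator; identity; product; inverse; respects)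

    -- The inverse is carried along so that the induction over `Generated` passes through `inverse`.
    PreservingUnit : Pred Unit _
    PreservingUnit g = Preserving (val g) × Preserving (inv g)

    generated-preserving : ∀ {p} {X : Pred Unit p} → (∀ {g} → g ∈ X → PreservingUnit g) →
                           ∀ {g} → g ∈ Generated X → PreservingUnit g
    generated-preserving X⊆ (generator g∈X) = X⊆ g∈X
    generated-preserving X⊆ identity        = preserving-1 , preserving-1
    generated-preserving X⊆ (product g h)   =
        preserving-* (proj₁ (generated-preserving X⊆ g)) (proj₁ (generated-preserving X⊆ h))
      , preserving-* (proj₂ (generated-preserving X⊆ h)) (proj₂ (generated-preserving X⊆ g))
    generated-preserving X⊆ (inverse g)     =
      proj₂ (generated-preserving X⊆ g) , proj₁ (generated-preserving X⊆ g)
    generated-preserving X⊆ (respects {g} {h} g≈h g∈) =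
        preserving-≈ g≈h (proj₁ (generated-preserving X⊆ g∈))
      , preserving-≈ (G.⁻¹-cong {g} {h} g≈h) (proj₂ (generated-preserving X⊆ g∈))

    generated-element : ∀ {p} {X : Pred Unit p} → (∀ {g} → g ∈ X → PreservingUnit g) → Element MS.1ᵐ →
                        ∀ {g} → g ∈ Generated X → Element (val g)
    generated-element X⊆ one {g} g∈ with proj₁ (generated-preserving X⊆ g∈) one
    ... | j , q , e = j , q , MS.≈ᵐ-trans (MS.≈ᵐ-sym (identityˡ (val g))) e
      where open Monoid MS.matrixMonoid using (identityˡ)

    -- The alternatives fit an involution, which is its own inverse, and an element of order three,
    -- whose inverse is its square.
    preservingUnit : ∀ {B} g → Preserving B → B MS.≈ᵐ val g →
                     B MS.≈ᵐ inv g ⊎ B MS.*ᵐ B MS.≈ᵐ inv g → PreservingUnit g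
    preservingUnit g b val≈ (inj₁ inv≈) = preserving-≈ val≈ b , preserving-≈ inv≈ b
    preservingUnit g b val≈ (inj₂ inv≈) = preserving-≈ val≈ b , preserving-≈ inv≈ (preserving-* b b)

    preservingUnit-≈ : ∀ {g h} → g G.≈ h → PreservingUnit h → PreservingUnit g
    preservingUnit-≈ {g} {h} g≈h (p , p′) =
      preserving-≈ (G.sym {g} {h} g≈h) p , preserving-≈ (G.⁻¹-cong {h} {g} (G.sym {g} {h} g≈h)) p′

    -- The determinant of `A` minus `n` squared. As elements carry the factor `n` squared, an
    -- invertible value means that 1 is not an eigenvalue of the scaled matrix.
    shiftedDet : MR.Matrix → R.Carrier
    shiftedDet (MR.matrix a b c d) = (a R.- n R.* n) R.* (d R.- n R.* n) R.- b R.* c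

    -- A - n² is invertible; its determinant is presented without subtraction.
    Regular : Pred MR.Matrix _
    Regular A = ∃[ a ] ∃[ d ] ∃[ e ] ∃[ r ]
      MR.Matrix.e₁₁ A R.≈ a R.+ n R.* n × MR.Matrix.e₂₂ A R.≈ d R.+ n R.* n ×
      a R.* d R.≈ e R.+ MR.Matrix.e₁₂ A R.* MR.Matrix.e₂₁ A × r S.* ⟦ e ⟧ S.≈ S.1#

    Invertible : Pred R.Carrier _
    Invertible e = ∃[ r ] r S.* ⟦ e ⟧ S.≈ S.1#

    invertible : ∀ {c e m y} → c R.* e R.≈ m → y S.* ⟦ m ⟧ S.≈ S.1# → Invertible e
    invertible {c} {e} {m} {y} ce ym = y S.* ⟦ c ⟧ ,
      S.trans (S.*-assoc _ _ _) (S.trans (S.*-congˡ (S.trans (S.sym (*-homo _ _)) (⟦⟧-cong ce))) ym)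

    regular : ∀ A → Invertible (shiftedDet A) → Regular A
    regular A (r , re) = _ , _ , _ , r , sub-add _ _ , sub-add _ _ , sub-add _ _ , re
      where
      sub-add : ∀ y z → y R.≈ y R.- z R.+ z
      sub-add y z = R.sym (R.trans (R.+-assoc _ _ _) (R.trans (R.+-congˡ (R.-‿inverseˡ z)) (R.+-identityʳ y)))

    regular⇒¬reflection : ∀ {A} → Regular A → ¬ MS.IsReflection (scale (x S.* x) A)
    regular⇒¬reflection {MR.matrix a b c d} (a′ , d′ , e , r , a≈ , d≈ , ad , re) (v , fixed , v≉0 , _) =
      v≉0 (MS.fixed⇒zero {n = ⟦ n ⟧ S.* ⟦ n ⟧}
        (*-inverse nx≈1 nx≈1)
        (split a≈) (split d≈)
        (S.trans (S.sym (*-homo _ _)) (S.trans (⟦⟧-cong ad) (S.trans (+-homo _ _) (S.+-congˡ (*-homo _ _)))))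
        re fixed)
      where
      split : ∀ {y z} → y R.≈ z R.+ n R.* n → ⟦ y ⟧ S.≈ ⟦ z ⟧ S.+ ⟦ n ⟧ S.* ⟦ n ⟧
      split e = S.trans (⟦⟧-cong e) (S.trans (+-homo _ _) (S.+-congˡ (*-homo _ _)))

    reflection-≈ : ∀ {A B} → A MS.≈ᵐ B → MS.IsReflection A → MS.IsReflection B
    reflection-≈ {A} {B} ((p , q) , (r , s)) (v , fixed , v≉0 , multiple) =
      v , to fixed , v≉0 , λ w w∈ → multiple w (from w∈)
      where
      to : ∀ {w} → MS.Fixed A w → MS.Fixed B w
      to (e₁ , e₂) = S.trans (S.sym (S.+-cong (S.*-congʳ p) (S.*-congʳ q))) e₁
                   , S.trans (S.sym (S.+-cong (S.*-congʳ r) (S.*-congʳ s))) e₂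
      from : ∀ {w} → MS.Fixed B w → MS.Fixed A w
      from (e₁ , e₂) = S.trans (S.+-cong (S.*-congʳ p) (S.*-congʳ q)) e₁
                     , S.trans (S.+-cong (S.*-congʳ r) (S.*-congʳ s)) e₂

    module _ {a c} {L : Set a} (Λ : L → MR.Matrix) (1≉0 : ¬ S.1# S.≈ S.0#)
      {Checked : Pred R.Carrier c} (checked⇒invertible : ∀ e → Checked e → Invertible e)
      (classify : ∀ j q → Checked (shiftedDet (element j q)) ⊎
        element j q MR.≈ᵐ n MR.·ᵐ scalar n ⊎
        ∃[ l ] element j q MR.≈ᵐ n MR.·ᵐ Λ l) where

      -- A reflection has a nonzero fixed vector and is not the identity, which excludes the first
      -- two outcomes of `classify`.
      reflection⇒letter : ∀ {A} → Element A → MS.IsReflection A → ∃[ l ] A MS.≈ᵐ scale x (Λ l)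
      reflection⇒letter (j , q , A≈) reflection with classify j q
      ... | inj₁ checked          = contradiction (reflection-≈ A≈ reflection)
        (regular⇒¬reflection (regular _ (checked⇒invertible _ checked)))
      ... | inj₂ (inj₁ central)   = contradiction
        (MS.1ᵐ-not-reflection (reflection-≈ (MS.≈ᵐ-trans A≈ (MS.≈ᵐ-trans (scale-cong _ central)
          (MS.≈ᵐ-trans (scale-reduce x _ xn≈1) scale-scalar))) reflection)) 1≉0
      ... | inj₂ (inj₂ (l , l≈))  = l , MS.≈ᵐ-trans A≈ (MS.≈ᵐ-trans (scale-cong _ l≈) (scale-reduce x _ xn≈1))

-- The reflections of G₇ and their conjugation

Vertex Kind Edge : Set
Vertex = Fin 4
Kind   = Fin 4
Edge   = Fin 6

-- The 22 reflections of G₇.  Modulo its centre, G₇ is the rotation group of the tetrahedron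
-- with vertices 0, …, 3.  The reflections of order 2 correspond to its edges, listed
-- lexicographically as 01, 02, 03, 12, 13, 23.  Each vertex is the centre of four reflections
-- of order 3, whose kinds 0, 1, 2, 3 are the conjugacy classes of t, t⁻¹, u⁻¹, u.
data Letter : Set where
  edge : Edge → Letter
  rot  : Kind → Vertex → Letter

-- The half-turn about the line through the midpoints of an edge and of the opposite one; opposite
-- edges therefore give the same double transposition.
translate : Edge → Vertex → Vertex
translate 0F = lookup (1F ∷ 0F ∷ 3F ∷ 2F ∷ [])
translate 5F = lookup (1F ∷ 0F ∷ 3F ∷ 2F ∷ [])
translate 1F = lookup (2F ∷ 3F ∷ 0F ∷ 1F ∷ [])
translate 4F = lookup (2F ∷ 3F ∷ 0F ∷ 1F ∷ [])
translate 2F = lookup (3F ∷ 2F ∷ 1F ∷ 0F ∷ [])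
translate 3F = lookup (3F ∷ 2F ∷ 1F ∷ 0F ∷ [])

-- Four three-cycles, each fixing its own vertex, that form one conjugacy class of the rotation
-- group.
rotate : Vertex → Vertex → Vertex
rotate 0F = lookup (0F ∷ 2F ∷ 3F ∷ 1F ∷ [])
rotate 1F = lookup (3F ∷ 1F ∷ 0F ∷ 2F ∷ [])
rotate 2F = lookup (1F ∷ 3F ∷ 2F ∷ 0F ∷ [])
rotate 3F = lookup (2F ∷ 0F ∷ 1F ∷ 3F ∷ [])

infixl 8 _^_ _▹_

-- Conjugation by t and by u⁻¹ turns the tetrahedron in the same sense.
_▹_ : Vertex → Letter → Vertex
v ▹ edge e   = translate e v
v ▹ rot 0F w = rotate w v
v ▹ rot 1F w = rotate w (rotate w v)
v ▹ rot 2F w = rotate w v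
v ▹ rot 3F w = rotate w (rotate w v)

end₁ end₂ : Edge → Vertex
end₁ = lookup (0F ∷ 0F ∷ 0F ∷ 1F ∷ 1F ∷ 2F ∷ [])
end₂ = lookup (1F ∷ 2F ∷ 3F ∷ 2F ∷ 3F ∷ 3F ∷ [])

-- The diagonal entries are junk values.
join : Vertex → Vertex → Edge
join 0F = lookup (0F ∷ 0F ∷ 1F ∷ 2F ∷ [])
join 1F = lookup (0F ∷ 0F ∷ 3F ∷ 4F ∷ [])
join 2F = lookup (1F ∷ 3F ∷ 0F ∷ 5F ∷ [])
join 3F = lookup (2F ∷ 4F ∷ 5F ∷ 0F ∷ [])

-- x ^ y stands for y⁻¹ x y.
_^_ : Letter → Letter → Letter
edge e  ^ b = edge (join (end₁ e ▹ b) (end₂ e ▹ b))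
rot k v ^ b = rot k (v ▹ b)

-- The letter of the inverse reflection.
opposite : Letter → Letter
opposite (edge e)   = edge e
opposite (rot 0F v) = rot 1F v
opposite (rot 1F v) = rot 0F v
opposite (rot 2F v) = rot 3F v
opposite (rot 3F v) = rot 2F v

allLetters? : ∀ {P : Letter → Set} → (∀ l → Dec (P l)) → Dec (∀ l → P l)
allLetters? P? = map′ (λ { (p , q) (edge e) → p e ; (p , q) (rot k v) → q k v })
                      (λ f → (λ e → f (edge e)) , λ k v → f (rot k v))
                      (Fin.all? (λ e → P? (edge e)) ×-dec
                       Fin.all? (λ k → Fin.all? (λ v → P? (rot k v))))

anyLetter? : ∀ {P : Letter → Set} → (∀ l → Dec (P l)) → Dec (∃[ l ] P l)
anyLetter? P? = map′ (λ { (inj₁ (e , p)) → edge e , p ; (inj₂ (k , v , p)) → rot k v , p })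
                     (λ { (edge e , p) → inj₁ (e , p) ; (rot k v , p) → inj₂ (k , v , p) })
                     (Fin.any? (λ e → P? (edge e)) ⊎-dec
                      Fin.any? (λ k → Fin.any? (λ v → P? (rot k v))))

infix 4 _≟_ _≟ᴼ_ _≟ᵐ_

_≟_ : Decidable {A = Letter} _≡_
edge e  ≟ edge f  = map′ (cong edge) (λ { refl → refl }) (e Fin.≟ f)
rot k v ≟ rot l w = map′ (λ { (refl , refl) → refl }) (λ { refl → refl , refl })
                         ((k Fin.≟ l) ×-dec (v Fin.≟ w))
edge _  ≟ rot _ _ = no λ ()
rot _ _ ≟ edge _  = no λ ()

-- Exact matrices of the reflections

module ℤ[√3]   = QuadraticExtension ℤ.+-*-commutativeRing (+ 3)
module ℤ[√3,i] = QuadraticExtension ℤ[√3].commutativeRing (ℤ[√3].embed -1ℤ)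

-- Four times the matrix of each reflection has its entries here, where equality is decided by
-- comparing integers.
O : CommutativeRing 0ℓ 0ℓ
O = ℤ[√3,i].commutativeRing

module O = CommutativeRing O
module M = Matrices O

int : ℤ → O.Carrier
int z = ℤ[√3,i].embed (ℤ[√3].embed z)

-- quad a b c d stands for (a + b √3) + (c + d √3) i.
quad : (a b c d : ℤ) → O.Carrier
quad a b c d = (a ℤ[√3].⊕ b √d) ℤ[√3,i].⊕ (c ℤ[√3].⊕ d √d) √d

4ᴼ 4i : O.Carrier
4ᴼ = int (+ 4)
4i = quad (+ 0) (+ 0) (+ 4) (+ 0)

_≟ᴼ_ : Decidable O._≈_
x ≟ᴼ y = ((_ ℤ.≟ _) ×-dec (_ ℤ.≟ _)) ×-dec ((_ ℤ.≟ _) ×-dec (_ ℤ.≟ _))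

_≟ᵐ_ : Decidable M._≈ᵐ_
A ≟ᵐ B = ((_ ≟ᴼ _) ×-dec (_ ≟ᴼ _)) ×-dec ((_ ≟ᴼ _) ×-dec (_ ≟ᴼ _))

conjugate : O.Carrier → O.Carrier
conjugate (x ℤ[√3,i].⊕ y √d) = x ℤ[√3,i].⊕ ℤ[√3].- y √d

-- The conjugate transpose, which for a unitary matrix is the inverse.
_* : M.Matrix → M.Matrix
M.matrix a b c d * = M.matrix (conjugate a) (conjugate c) (conjugate b) (conjugate d)

-- The three Pauli matrices and their negatives, times four. Opposite edges differ by the sign; edge
-- `2F` is `s`.
Λᵉ : Edge → M.Matrix
Λᵉ 0F = M.matrix O.0# 4ᴼ 4ᴼ O.0#
Λᵉ 1F = M.matrix O.0# 4i (O.- 4i) O.0#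
Λᵉ 2F = M.matrix 4ᴼ O.0# O.0# (O.- 4ᴼ)
Λᵉ 3F = M.matrix (O.- 4ᴼ) O.0# O.0# 4ᴼ
Λᵉ 4F = M.matrix O.0# (O.- 4i) 4i O.0#
Λᵉ 5F = M.matrix O.0# (O.- 4ᴼ) (O.- 4ᴼ) O.0#

-- The entry at `0F` is four times `t`; the other three are its conjugates under reflections of
-- order 2.
Λᵗ : Vertex → M.Matrix
Λᵗ = lookup (M.matrix p p (O.- q) q ∷ M.matrix q (O.- q) p p ∷
             M.matrix q q (O.- p) p ∷ M.matrix p (O.- p) q q ∷ [])
  where
  p = quad (+ 1) (+ 1) -1ℤ (+ 1)
  q = quad (+ 1) -1ℤ (+ 1) (+ 1)

-- Four times the matrices of the reflections.  They are unitary, transposition maps G₇ to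
-- itself, and it takes the reflections of the class of t at v to those of u at translate 1F v.
Λ : Letter → M.Matrix
Λ (edge e)   = Λᵉ e
Λ (rot 0F v) = Λᵗ v
Λ (rot 1F v) = Λᵗ v *
Λ (rot 2F v) = (Λᵗ (translate 1F v) M.ᵀ) *
Λ (rot 3F v) = Λᵗ (translate 1F v) M.ᵀ

-- Words up to Hurwitz moves

infix 4 _∼_

-- Only forward moves are constructors, as in `_⇝_`; symmetry is derived from the finite order of a
-- move on a pair.
data _∼_ : List Letter → List Letter → Set where
  swap    : ∀ x y w → x ∷ y ∷ w ∼ y ∷ x ^ y ∷ w
  prepend : ∀ x {v w} → v ∼ w → x ∷ v ∼ x ∷ w
  ∼-refl  : ∀ {w} → w ∼ w
  ∼-trans : ∀ {u v w} → u ∼ v → v ∼ w → u ∼ w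

∼-++ : ∀ {v w} → v ∼ w → ∀ z → v ++ z ∼ w ++ z
∼-++ (swap x y w)    z = swap x y (w ++ z)
∼-++ (prepend x p)   z = prepend x (∼-++ p z)
∼-++ ∼-refl          z = ∼-refl
∼-++ (∼-trans p q)   z = ∼-trans (∼-++ p z) (∼-++ q z)

twist : ℕ → Letter × Letter → Letter × Letter
twist zero    p       = p
twist (suc k) (x , y) = twist k (y , x ^ y)

∼-twist : ∀ k x y w → x ∷ y ∷ w ∼ proj₁ (twist k (x , y)) ∷ proj₂ (twist k (x , y)) ∷ w
∼-twist zero    x y w = ∼-refl
∼-twist (suc k) x y w = ∼-trans (swap x y w) (∼-twist k y (x ^ y) w)

opaque
  -- With 12 as a common period on all pairs of letters, the eleventh power of a move is its
  -- inverse.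
  twist-order : ∀ x y → twist 12 (x , y) ≡ (x , y)
  twist-order = toWitness {a? = allLetters? λ x → allLetters? λ y → ×.≡-dec _≟_ _≟_ _ _} _

  ^-opposite : ∀ x y → x ^ opposite y ^ y ≡ x
  ^-opposite = toWitness {a? = allLetters? λ x → allLetters? λ y → _ ≟ _} _

  opposite-^ : ∀ x y → x ^ y ^ opposite y ≡ x
  opposite-^ = toWitness {a? = allLetters? λ x → allLetters? λ y → _ ≟ _} _

∼-sym : ∀ {v w} → v ∼ w → w ∼ v
∼-sym (swap x y w)  =
  subst (λ p → y ∷ x ^ y ∷ w ∼ proj₁ p ∷ proj₂ p ∷ w) (twist-order x y) (∼-twist 11 y (x ^ y) w)
∼-sym (prepend x p) = prepend x (∼-sym p)
∼-sym ∼-refl        = ∼-refl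
∼-sym (∼-trans p q) = ∼-trans (∼-sym q) (∼-sym p)

data Crossing : Set where
  σ⁺ σ⁻ : ℕ → Crossing

infixl 5 _⋆_

-- A crossing beyond the end of the word leaves it unchanged.
_⋆_ : List Letter → Crossing → List Letter
[]          ⋆ _        = []
(x ∷ [])    ⋆ _        = x ∷ []
(x ∷ y ∷ w) ⋆ σ⁺ zero    = y ∷ x ^ y ∷ w
(x ∷ y ∷ w) ⋆ σ⁻ zero    = y ^ opposite x ∷ x ∷ w
(x ∷ y ∷ w) ⋆ σ⁺ (suc i) = x ∷ ((y ∷ w) ⋆ σ⁺ i)
(x ∷ y ∷ w) ⋆ σ⁻ (suc i) = x ∷ ((y ∷ w) ⋆ σ⁻ i)

∼-⋆ : ∀ w c → w ∼ (w ⋆ c)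
∼-⋆ []          c          = ∼-refl
∼-⋆ (x ∷ [])    c          = ∼-refl
∼-⋆ (x ∷ y ∷ w) (σ⁺ zero)    = swap x y w
∼-⋆ (x ∷ y ∷ w) (σ⁻ zero)    = ∼-sym
  (subst (λ z → y ^ opposite x ∷ x ∷ w ∼ x ∷ z ∷ w) (^-opposite y x) (swap (y ^ opposite x) x w))
∼-⋆ (x ∷ y ∷ w) (σ⁺ (suc i)) = prepend x (∼-⋆ (y ∷ w) (σ⁺ i))
∼-⋆ (x ∷ y ∷ w) (σ⁻ (suc i)) = prepend x (∼-⋆ (y ∷ w) (σ⁻ i))

∼-braid : ∀ w β → w ∼ foldl _⋆_ w β
∼-braid w []      = ∼-refl
∼-braid w (c ∷ β) = ∼-trans (∼-⋆ w c) (∼-braid (w ⋆ c) β)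

-- A label that conjugation among the letters in `Q` cannot change, so that its multiset is a
-- Hurwitz invariant. It is used for the kind on all letters, the axis on edges, and the letter
-- itself on a single axis.
record Stable {X : Set} (f : Letter → X) (Q : Pred Letter 0ℓ) : Set where
  field
    closed    : ∀ {x y} → Q x → Q y → Q (x ^ y)
    opposite-closed : ∀ {x} → Q x → Q (opposite x)
    invariant : ∀ {x y} → Q x → Q y → f (x ^ y) ≡ f x

module _ {X : Set} {f : Letter → X} {Q : Pred Letter 0ℓ} (stable : Stable f Q) where
  open Stable stable

  ∼-All : ∀ {v w} → v ∼ w → All Q v → All Q w
  ∼-All (swap x y w)  (px ∷ py ∷ p) = py ∷ closed px py ∷ p
  ∼-All (prepend x e) (px ∷ p)      = px ∷ ∼-All e p
  ∼-All ∼-refl        p             = p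
  ∼-All (∼-trans d e) p             = ∼-All e (∼-All d p)

  ∼-↭ : ∀ {v w} → v ∼ w → All Q v → map f v ↭ map f w
  ∼-↭ (swap x y w)  (px ∷ py ∷ p) rewrite invariant px py = Permutation.swap _ _ ↭-refl
  ∼-↭ (prepend x e) (px ∷ p)      = prep _ (∼-↭ e p)
  ∼-↭ ∼-refl        p             = ↭-refl
  ∼-↭ (∼-trans d e) p             = ↭-trans (∼-↭ d p) (∼-↭ e (∼-All d p))

opaque
  -- A swap moves the right letter to the left unchanged, so a chosen letter travels to the front
  -- while those it passes get conjugated.
  front : ∀ {P : Pred Letter 0ℓ} {w} → Any P w → ∃[ x ] ∃[ v ] P x × w ∼ x ∷ v
  front (here px)       = _ , _ , px , ∼-refl
  front (there {y} any) with front any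
  ... | x , v , px , e = x , y ^ x ∷ v , px , ∼-trans (prepend y e) (swap y x v)

module _ {X : Set} {f : Letter → X} {Q : Pred Letter 0ℓ} (stable : Stable f Q) where

  opaque
    -- Moves preserve the multiset of labels, so after a letter of label `a` is brought to the
    -- front, its label can be cancelled.
    pull : ∀ {w a as} → All Q w → map f w ↭ a ∷ as →
           ∃[ x ] ∃[ v ] f x ≡ a × w ∼ x ∷ v × Q x × All Q v × map f v ↭ as
    pull {w} {a} q w↭ with ∈-map⁻ f (∈-resp-↭ (↭-sym w↭) (here refl))
    ... | y , y∈w , refl with front (Any.map (cong f) y∈w)
    ...   | x , v , fy≡fx , e with ∼-All stable e q
    ...     | px ∷ pv = x , v , sym fy≡fx , e , px , pv ,
      drop-∷ (↭-trans (↭-reflexive (cong (_∷ map f v) fy≡fx)) (↭-trans (↭-sym (∼-↭ stable e q)) w↭))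

    ∼-remove : ∀ {w x v as} → All Q w → w ∼ x ∷ v → map f w ↭ f x ∷ as → All Q v × map f v ↭ as
    ∼-remove q e w↭ = All.tail (∼-All stable e q) , drop-∷ (↭-trans (↭-sym (∼-↭ stable e q)) w↭)

Axis : Set
Axis = Edge ⊎ Vertex

-- Opposite edges share an axis, which is named after the one listed first.
axis : Letter → Axis
axis (edge e)  = inj₁ (lookup (0F ∷ 1F ∷ 2F ∷ 2F ∷ 1F ∷ 0F ∷ []) e)
axis (rot k v) = inj₂ v

_≟ᵃ_ : (a b : Axis) → Dec (a ≡ b)
_≟ᵃ_ = ⊎.≡-dec Fin._≟_ Fin._≟_

Coaxial : List Letter → Set
Coaxial w = ∃[ a ] All (λ x → axis x ≡ a) w

coaxial? : ∀ w → Dec (Coaxial w)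
coaxial? []      = yes (inj₁ 0F , [])
coaxial? (x ∷ w) = map′ (λ p → axis x , refl ∷ p) (λ { (_ , refl ∷ p) → p }) (all? (λ y → axis y ≟ᵃ axis x) w)

HeadTail : (Letter → Set) → (List Letter → Set) → List Letter → Set
HeadTail P R []      = ⊥
HeadTail P R (x ∷ w) = P x × R w

headTail? : ∀ {P R} → (∀ x → Dec (P x)) → (∀ w → Dec (R w)) → ∀ w → Dec (HeadTail P R w)
headTail? P? R? []      = no λ ()
headTail? P? R? (x ∷ w) = P? x ×-dec R? w

Reach : (List Letter → Set) → List (List Crossing) → Letter → List Letter → Set
Reach R βs x w = Any (λ β → HeadTail (x ≡_) R (foldl _⋆_ w β)) βs

reach? : ∀ {R} → (∀ w → Dec (R w)) → ∀ βs x w → Dec (Reach R βs x w)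
reach? R? βs x w = any? (λ β → headTail? (x ≟_) R? (foldl _⋆_ w β)) βs

reach-∼ : ∀ {R βs x w} → Reach R βs x w → ∃[ v ] w ∼ x ∷ v × R v
reach-∼ {w = w} any with Any.satisfied any
... | β , p with foldl _⋆_ w β | ∼-braid w β | p
...   | x ∷ v | e | refl , r = v , e , r

kind : Letter → Maybe Kind
kind (edge e)  = nothing
kind (rot k v) = just k

-- An arbitrary representative of each class, serving as the common letter to strip from two words.
standard : Maybe Kind → Letter
standard nothing  = edge 0F
standard (just k) = rot k 0F

-- Finite checks on short words

pattern σ₁ = σ⁺ 0
pattern σ₂ = σ⁺ 1
pattern σ₃ = σ⁺ 2
pattern τ₁ = σ⁻ 0
pattern τ₂ = σ⁻ 1
pattern τ₃ = σ⁻ 2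

-- The braids were found by a computer search.
mixedBraids edgeBraids tripleBraids quadBraids : List (List Crossing)
mixedBraids =
  (σ₂ ∷ σ₁ ∷ []) ∷
  (σ₂ ∷ τ₁ ∷ []) ∷
  (σ₁ ∷ τ₂ ∷ σ₁ ∷ []) ∷
  (τ₁ ∷ τ₁ ∷ σ₂ ∷ τ₁ ∷ []) ∷
  (τ₂ ∷ σ₁ ∷ []) ∷
  (σ₂ ∷ σ₂ ∷ σ₂ ∷ σ₁ ∷ []) ∷
  (τ₂ ∷ τ₁ ∷ []) ∷
  (σ₂ ∷ σ₂ ∷ σ₂ ∷ τ₁ ∷ []) ∷
  [] ∷
  (σ₂ ∷ σ₁ ∷ σ₁ ∷ []) ∷ []
edgeBraids =
  (σ₂ ∷ σ₁ ∷ []) ∷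
  (σ₂ ∷ τ₁ ∷ []) ∷
  (τ₂ ∷ σ₁ ∷ []) ∷ []
tripleBraids =
  [] ∷
  (σ₁ ∷ σ₂ ∷ σ₂ ∷ σ₁ ∷ []) ∷
  (τ₁ ∷ σ₂ ∷ σ₂ ∷ τ₁ ∷ []) ∷
  (τ₂ ∷ τ₁ ∷ τ₁ ∷ []) ∷
  (τ₂ ∷ τ₂ ∷ σ₁ ∷ σ₁ ∷ []) ∷
  (τ₁ ∷ τ₁ ∷ []) ∷
  (σ₂ ∷ τ₁ ∷ τ₁ ∷ []) ∷ []
quadBraids =
  (σ₂ ∷ τ₁ ∷ τ₁ ∷ []) ∷
  (σ₂ ∷ σ₂ ∷ τ₁ ∷ τ₁ ∷ []) ∷
  (σ₁ ∷ σ₂ ∷ σ₂ ∷ σ₁ ∷ []) ∷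
  (τ₁ ∷ σ₂ ∷ σ₂ ∷ τ₁ ∷ []) ∷
  (τ₁ ∷ τ₁ ∷ []) ∷
  [] ∷
  (σ₃ ∷ σ₂ ∷ σ₁ ∷ σ₁ ∷ []) ∷ []

opaque
  -- The stripping step for words with letters of both orders: the class of `z` alone determines the
  -- letter that comes to the front.
  mixed-reach : ∀ e k v z → Reach (λ _ → ⊤) mixedBraids (standard (kind z)) (edge e ∷ rot k v ∷ z ∷ [])
  mixed-reach = toWitness {a? = Fin.all? λ e → Fin.all? λ k → Fin.all? λ v → allLetters? λ z →
    reach? (λ _ → yes _) mixedBraids (standard (kind z)) (edge e ∷ rot k v ∷ z ∷ [])} _

  -- An edge on another axis conjugates a letter to the opposite edge. As `e` and `f` have different
  -- axes, one of them can do so to `g`, so its axis alone fixes the letter reached.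
  edges-reach : ∀ e f g → axis (edge e) ≡ axis (edge f) ⊎
    Reach (λ _ → ⊤) edgeBraids ([ edge , rot 0F ]′ (axis (edge g))) (edge e ∷ edge f ∷ edge g ∷ [])
  edges-reach = toWitness {a? = Fin.all? λ e → Fin.all? λ f → Fin.all? λ g →
    (axis (edge e) ≟ᵃ axis (edge f)) ⊎-dec
    reach? (λ _ → yes _) edgeBraids ([ edge , rot 0F ]′ (axis (edge g))) (edge e ∷ edge f ∷ edge g ∷ [])} _

  -- The first two vertices are normalised to 0 and 1. The rest has to stay non-coaxial for the
  -- induction to continue, which may fail for the single vertex `u₀`.
  quadruples-reach : ∀ k l m n a b → ∃[ u₀ ] ∀ u → u ≡ u₀ ⊎
    Reach (λ v → ¬ Coaxial v) quadBraids (rot k u) (rot k 0F ∷ rot l 1F ∷ rot m a ∷ rot n b ∷ [])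
  quadruples-reach = toWitness {a? =
    Fin.all? λ k → Fin.all? λ l → Fin.all? λ m → Fin.all? λ n → Fin.all? λ a → Fin.all? λ b →
    Fin.any? λ u₀ → Fin.all? λ u → (u Fin.≟ u₀) ⊎-dec
    reach? (λ v → ¬? (coaxial? v)) quadBraids (rot k u) (rot k 0F ∷ rot l 1F ∷ rot m a ∷ rot n b ∷ [])} _

-- The exponents 0 to 4 are enough for the three checks on pairs that follow.
Twisted : Letter × Letter → Letter × Letter → Set
Twisted p q = ∃[ i ] twist (toℕ {5} i) p ≡ q

-- A record, so that the two products are not multiplied out whenever the type is normalised.
record Distinct (x y x′ y′ : Letter) : Set where
  constructor distinct
  field
    products-differ : ¬ Λ x M.*ᵐ Λ y M.≈ᵐ Λ x′ M.*ᵐ Λ y′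
open Distinct public

twisted⊎distinct? : ∀ x y x′ y′ → Dec (Twisted (x , y) (x′ , y′) ⊎ Distinct x y x′ y′)
twisted⊎distinct? x y x′ y′ =
  Fin.any? (λ i → ×.≡-dec _≟_ _≟_ (twist (toℕ i) (x , y)) (x′ , y′)) ⊎-dec
  map′ distinct products-differ (¬? (_ ≟ᵐ _))

opaque
  -- The end of the induction on edges: two pairs with the same two different axes lie in one orbit
  -- of the Hurwitz move, or their products tell them apart.
  edge-pairs : ∀ e f e′ f′ →
    axis (edge e) ≡ axis (edge f) ⊎ axis (edge e) ≢ axis (edge e′) ⊎ axis (edge f) ≢ axis (edge f′) ⊎
    Twisted (edge e , edge f) (edge e′ , edge f′) ⊎
    Distinct (edge e) (edge f) (edge e′) (edge f′)
  edge-pairs = toWitness {a? = Fin.all? λ e → Fin.all? λ f → Fin.all? λ e′ → Fin.all? λ f′ →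
    (axis (edge e) ≟ᵃ axis (edge f)) ⊎-dec ¬? (axis (edge e) ≟ᵃ axis (edge e′)) ⊎-dec
    ¬? (axis (edge f) ≟ᵃ axis (edge f′)) ⊎-dec twisted⊎distinct? (edge e) (edge f) (edge e′) (edge f′)} _

  mixed-pairs : ∀ k e v e′ v′ → Twisted (edge e , rot k v) (edge e′ , rot k v′) ⊎
    Distinct (edge e) (rot k v) (edge e′) (rot k v′)
  mixed-pairs = toWitness {a? = Fin.all? λ k → Fin.all? λ e → Fin.all? λ v → Fin.all? λ e′ → Fin.all? λ v′ →
    twisted⊎distinct? (edge e) (rot k v) (edge e′) (rot k v′)} _

  rot-pairs : ∀ k l v w v′ w′ → v ≡ w ⊎ v′ ≡ w′ ⊎
    Twisted (rot k v , rot l w) (rot k v′ , rot l w′) ⊎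
    Distinct (rot k v) (rot l w) (rot k v′) (rot l w′)
  rot-pairs = toWitness {a? =
    Fin.all? λ k → Fin.all? λ l → Fin.all? λ v → Fin.all? λ w → Fin.all? λ v′ → Fin.all? λ w′ →
    (v Fin.≟ w) ⊎-dec (v′ Fin.≟ w′) ⊎-dec twisted⊎distinct? (rot k v) (rot l w) (rot k v′) (rot l w′)} _

record Distinct₃ (x y z x′ y′ z′ : Letter) : Set where
  constructor distinct₃
  field
    products-differ₃ : ¬ Λ x M.*ᵐ (Λ y M.*ᵐ Λ z) M.≈ᵐ Λ x′ M.*ᵐ (Λ y′ M.*ᵐ Λ z′)
open Distinct₃ public

-- The `b` are the vertices of a rival word. Its last two are different, so that the case of two
-- letters applies once equal heads are cancelled.
Separated : (k l m : Kind) (a₁ a₂ a₃ : Vertex) → Set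
Separated k l m a₁ a₂ a₃ = ∀ b₁ →
  Reach (λ v → ¬ Coaxial v) tripleBraids (rot k b₁) (rot k a₁ ∷ rot l a₂ ∷ rot m a₃ ∷ []) ⊎
  (∀ b₂ b₃ → b₂ ≡ b₃ ⊎ Distinct₃ (rot k a₁) (rot l a₂) (rot m a₃) (rot k b₁) (rot l b₂) (rot m b₃))

-- A is the product of the first three matrices, passed on so that it is computed only once.
distinct₃? : ∀ {x y z A} x′ y′ z′ → A ≡ Λ x M.*ᵐ (Λ y M.*ᵐ Λ z) → Dec (Distinct₃ x y z x′ y′ z′)
distinct₃? {A = A} x′ y′ z′ A≡ = map′
  (λ d → distinct₃ (subst (λ A → ¬ A M.≈ᵐ B) A≡ d))
  (λ d → subst (λ A → ¬ A M.≈ᵐ B) (sym A≡) (products-differ₃ d))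
  (¬? (A ≟ᵐ B))
  where B = Λ x′ M.*ᵐ (Λ y′ M.*ᵐ Λ z′)

separated? : ∀ k l m a₁ a₂ a₃ {A} → A ≡ Λ (rot k a₁) M.*ᵐ (Λ (rot l a₂) M.*ᵐ Λ (rot m a₃)) →
             Dec (Separated k l m a₁ a₂ a₃)
separated? k l m a₁ a₂ a₃ A≡ = Fin.all? λ b₁ →
  reach? (λ v → ¬? (coaxial? v)) tripleBraids (rot k b₁) (rot k a₁ ∷ rot l a₂ ∷ rot m a₃ ∷ []) ⊎-dec
  Fin.all? (λ b₂ → Fin.all? λ b₃ → (b₂ Fin.≟ b₃) ⊎-dec distinct₃? (rot k b₁) (rot l b₂) (rot m b₃) A≡)

opaque
  -- Up to conjugation, a non-coaxial triple of vertices begins with 0, 1 or equals 0, 0, 1.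
  triples-separated : ∀ k l m → (∀ a → Separated k l m 0F 1F a) × Separated k l m 0F 0F 1F
  triples-separated = toWitness {a? = Fin.all? λ k → Fin.all? λ l → Fin.all? λ m →
    Fin.all? (λ a → separated? k l m 0F 1F a refl) ×-dec separated? k l m 0F 0F 1F refl} _

-- Conjugation, axes and symmetry

opaque
  -- Self-distributivity makes simultaneous conjugation of all letters compatible with Hurwitz
  -- moves.
  ^-distrib : ∀ x y z → x ^ y ^ z ≡ x ^ z ^ (y ^ z)
  ^-distrib = toWitness {a? = allLetters? λ x → allLetters? λ y → allLetters? λ z → _ ≟ _} _

  coaxial⇒fixed : ∀ x y → axis x ≢ axis y ⊎ x ^ y ≡ x
  coaxial⇒fixed = toWitness {a? = allLetters? λ x → allLetters? λ y → ¬? (_ ≟ᵃ _) ⊎-dec (_ ≟ _)} _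

  fixed⇒coaxial : ∀ x y → x ^ y ≢ x ⊎ axis x ≡ axis y
  fixed⇒coaxial = toWitness {a? = allLetters? λ x → allLetters? λ y → ¬? (_ ≟ _) ⊎-dec (_ ≟ᵃ _)} _

  edge-axis-^ : ∀ e f → axis (edge e ^ edge f) ≡ axis (edge e)
  edge-axis-^ = toWitness {a? = Fin.all? λ e → Fin.all? λ f → _ ≟ᵃ _} _

  -- The rotation group of the tetrahedron is doubly transitive on the vertices, and two
  -- conjugations by letters suffice. This reduces two different vertices to 0 and 1.
  doubly-transitive : ∀ v w → v ≡ w ⊎ ∃[ c ] ∃[ d ] v ▹ c ▹ d ≡ 0F × w ▹ c ▹ d ≡ 1F
  doubly-transitive = toWitness {a? = Fin.all? λ v → Fin.all? λ w → (v Fin.≟ w) ⊎-dec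
    anyLetter? λ c → anyLetter? λ d → (_ Fin.≟ _) ×-dec (_ Fin.≟ _)} _

  third-vertex : ∀ (u v : Vertex) → ∃[ w ] w ≢ u × w ≢ v
  third-vertex = toWitness {a? = Fin.all? λ u → Fin.all? λ v → Fin.any? λ w →
    ¬? (_ Fin.≟ _) ×-dec ¬? (_ Fin.≟ _)} _

  -- The full twist of two non-coaxial rotations moves the second one.
  full-twist-moves : ∀ k l a b → a ≡ b ⊎ b ▹ (rot k a ^ rot l b) ≢ b
  full-twist-moves = toWitness {a? = Fin.all? λ k → Fin.all? λ l → Fin.all? λ a → Fin.all? λ b →
    (_ Fin.≟ _) ⊎-dec ¬? (_ Fin.≟ _)} _

  std-axis : ∀ e → axis ([ edge , rot 0F ]′ (axis (edge e))) ≡ axis (edge e)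
  std-axis = toWitness {a? = Fin.all? λ e → _ ≟ᵃ _} _

resolve : ∀ {A B : Set} → A → ¬ A ⊎ B → B
resolve a (inj₁ ¬a) = contradiction a ¬a
resolve a (inj₂ b)  = b

▹-cancel : ∀ v c → v ▹ c ▹ opposite c ≡ v
▹-cancel v c with opposite-^ (rot 0F v) c
... | e = rot-injective e
  where
  rot-injective : ∀ {v w} → rot 0F v ≡ rot 0F w → v ≡ w
  rot-injective refl = refl

▹-injective : ∀ {v w} c → v ▹ c ≡ w ▹ c → v ≡ w
▹-injective {v} {w} c e = trans (sym (▹-cancel v c)) (trans (cong (_▹ opposite c) e) (▹-cancel w c))

-- Sharing an axis amounts to being fixed under conjugation by one another, and `^-distrib` carries
-- this over to the conjugates.
axis-^ : ∀ {x y} c → axis x ≡ axis y → axis (x ^ c) ≡ axis (y ^ c)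
axis-^ {x} {y} c e = resolve (trans (sym (^-distrib x y c)) (cong (_^ c) (resolve e (coaxial⇒fixed x y))))
                             (fixed⇒coaxial (x ^ c) (y ^ c))

coaxial-^ : ∀ c {w} → Coaxial w → Coaxial (map (_^ c) w)
coaxial-^ c {[]}    _                = inj₁ 0F , []
coaxial-^ c {x ∷ w} (a , refl ∷ p) = axis (x ^ c) , refl ∷ All.map⁺ (All.map (axis-^ c) p)

map-^-opposite : ∀ c w → map (_^ c) (map (_^ opposite c) w) ≡ w
map-^-opposite c w = trans (sym (map-∘ w)) (trans (map-cong (λ x → ^-opposite x c) w) (map-id w))

map-opposite-^ : ∀ c w → map (_^ opposite c) (map (_^ c) w) ≡ w
map-opposite-^ c w = trans (sym (map-∘ w)) (trans (map-cong (λ x → opposite-^ x c) w) (map-id w))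

∼-^ : ∀ c {v w} → v ∼ w → map (_^ c) v ∼ map (_^ c) w
∼-^ c (swap x y w)  = subst (λ z → x ^ c ∷ y ^ c ∷ map (_^ c) w ∼ y ^ c ∷ z ∷ map (_^ c) w)
                            (sym (^-distrib x y c)) (swap _ _ _)
∼-^ c (prepend x p) = prepend (x ^ c) (∼-^ c p)
∼-^ c ∼-refl        = ∼-refl
∼-^ c (∼-trans p q) = ∼-trans (∼-^ c p) (∼-^ c q)

axis-opposite : ∀ x → axis (opposite x) ≡ axis x
axis-opposite (edge e)   = refl
axis-opposite (rot 0F v) = refl
axis-opposite (rot 1F v) = refl
axis-opposite (rot 2F v) = refl
axis-opposite (rot 3F v) = refl

IsEdge : Letter → Set
IsEdge x = ∃[ e ] x ≡ edge e

IsRot : Letter → Set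
IsRot x = ∃[ k ] ∃[ v ] x ≡ rot k v

isEdge? : ∀ x → Dec (IsEdge x)
isEdge? (edge e)  = yes (e , refl)
isEdge? (rot k v) = no λ ()

kind-stable : Stable kind (λ _ → ⊤)
kind-stable = record
  { closed = λ _ _ → tt
  ; opposite-closed = λ _ → tt
  ; invariant = λ { {edge e} _ _ → refl ; {rot k v} _ _ → refl }
  }

axis-stable : Stable axis IsEdge
axis-stable = record
  { closed = λ { (e , refl) _ → _ , refl }
  ; opposite-closed = λ { (e , refl) → e , refl }
  ; invariant = λ { (e , refl) (f , refl) → edge-axis-^ e f }
  }

coaxial-stable : ∀ a → Stable id (λ x → axis x ≡ a)
coaxial-stable a = record
  { closed = λ {x} {y} p q → trans (cong axis (fixed {x} {y} (trans p (sym q)))) p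
  ; opposite-closed = λ {x} p → trans (axis-opposite x) p
  ; invariant = λ p q → fixed (trans p (sym q))
  }
  where
  fixed : ∀ {x y} → axis x ≡ axis y → x ^ y ≡ x
  fixed {x} {y} e = resolve e (coaxial⇒fixed x y)

coaxial-∼ : ∀ {v w} → v ∼ w → Coaxial v → Coaxial w
coaxial-∼ e (a , p) = a , ∼-All (coaxial-stable a) e p

↭⇒∼ : ∀ {a v w} → All (λ x → axis x ≡ a) v → v ↭ w → v ∼ w
↭⇒∼ p Permutation.refl = ∼-refl
↭⇒∼ (_ ∷ p) (prep x e) = prepend x (↭⇒∼ p e)
↭⇒∼ {a} {_ ∷ _ ∷ v} (px ∷ py ∷ p) (Permutation.swap x y e) = ∼-trans
  (subst (λ z → x ∷ y ∷ v ∼ y ∷ z ∷ v) (resolve (trans px (sym py)) (coaxial⇒fixed x y)) (swap x y v))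
  (prepend y (prepend x (↭⇒∼ p e)))
↭⇒∼ p (Permutation.trans d e) = ∼-trans (↭⇒∼ p d) (↭⇒∼ (All-resp-↭ d p) e)

non-coaxial : ∀ {x w} → ¬ Coaxial (x ∷ w) → ∃[ y ] ∃[ v ] axis y ≢ axis x × w ∼ y ∷ v
non-coaxial {x} {w} ¬coaxial = front (All.¬All⇒Any¬ (λ y → axis y ≟ᵃ axis x) w
  λ p → ¬coaxial (axis x , refl ∷ p))

non-coaxial-pair : ∀ {w} → ¬ Coaxial w → ∃[ x ] ∃[ y ] ∃[ v ] axis y ≢ axis x × w ∼ x ∷ y ∷ v
non-coaxial-pair {[]}    ¬coaxial = contradiction (inj₁ 0F , []) ¬coaxial
non-coaxial-pair {x ∷ w} ¬coaxial =
  let y , v , y≢x , d = non-coaxial ¬coaxial in x , y , v , y≢x , prepend x d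

∈⇒↭ : ∀ {X : Set} {a : X} {as} → a List.∈ as → ∃[ bs ] as ↭ a ∷ bs
∈⇒↭ a∈ with ∈-∃++ a∈
... | bs , cs , refl = bs ++ cs , shift _ bs cs

map-↭-[] : ∀ {X : Set} {f : Letter → X} {w} → map f w ↭ [] → w ≡ []
map-↭-[] {w = []}    _ = refl
map-↭-[] {w = x ∷ w} e with () ← ↭-empty-inv e

kind⇒rot : ∀ {k x} → kind x ≡ just k → ∃[ v ] x ≡ rot k v
kind⇒rot {x = rot k v} refl = v , refl

-- Classification of words by product and labels

-- The classification sees the matrices only through the conjugation rule, injectivity, and the
-- distinct products found by the checks.
record FaithfulLabelling (G : Group 0ℓ 0ℓ) (ρ : Letter → Group.Carrier G) : Set where
  open Group G
  field
    ρ-^         : ∀ x y → ρ x ∙ ρ y ≈ ρ y ∙ ρ (x ^ y)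
    ρ-injective : ∀ {x y} → ρ x ≈ ρ y → x ≡ y
    ρ-pair      : ∀ x y x′ y′ → ρ x ∙ ρ y ≈ ρ x′ ∙ ρ y′ → ¬ Distinct x y x′ y′
    ρ-triple    : ∀ x y z x′ y′ z′ → ρ x ∙ (ρ y ∙ ρ z) ≈ ρ x′ ∙ (ρ y′ ∙ ρ z′) →
                  ¬ Distinct₃ x y z x′ y′ z′

module Classification (G : Group 0ℓ 0ℓ) (ρ : Letter → Group.Carrier G)
  (labelling : FaithfulLabelling G ρ) where
  open Group G hiding (refl; sym; trans)
  open FaithfulLabelling labelling
  open GroupProperties G using (∙-cancelˡ)

  ∏ρ : List Letter → Carrier
  ∏ρ = foldr (λ x g → ρ x ∙ g) ε

  infix 4 _≈ʷ_

  _≈ʷ_ : List Letter → List Letter → Set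
  v ≈ʷ w = ∏ρ v ≈ ∏ρ w

  ∼⇒≈ʷ : ∀ {v w} → v ∼ w → v ≈ʷ w
  ∼⇒≈ʷ (swap x y w)  = trans≈ (sym≈ (assoc _ _ _)) (trans≈ (∙-congʳ (ρ-^ x y)) (assoc _ _ _))
    where open Group G using () renaming (trans to trans≈; sym to sym≈)
  ∼⇒≈ʷ (prepend x p) = ∙-congˡ (∼⇒≈ʷ p)
  ∼⇒≈ʷ ∼-refl        = Group.refl G
  ∼⇒≈ʷ (∼-trans p q) = Group.trans G (∼⇒≈ʷ p) (∼⇒≈ʷ q)

  ∼-≈ʷ : ∀ {v v′ w w′} → v ∼ v′ → w ∼ w′ → v ≈ʷ w → v′ ≈ʷ w′
  ∼-≈ʷ p q e = Group.trans G (Group.sym G (∼⇒≈ʷ p)) (Group.trans G e (∼⇒≈ʷ q))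

  ∼-cancel : ∀ {x v v′ w w′} → v ∼ x ∷ v′ → w ∼ x ∷ w′ → v ≈ʷ w → v′ ≈ʷ w′
  ∼-cancel {x} p q e = ∙-cancelˡ (ρ x) _ _ (∼-≈ʷ p q e)

  ∼-join : ∀ {x v v′ w w′} → v ∼ x ∷ v′ → w ∼ x ∷ w′ → v′ ∼ w′ → v ∼ w
  ∼-join p q e = ∼-trans p (∼-trans (prepend _ e) (∼-sym q))

  ∏ρ-^ : ∀ c w → ∏ρ w ∙ ρ c ≈ ρ c ∙ ∏ρ (map (_^ c) w)
  ∏ρ-^ c []      = Group.trans G (identityˡ _) (Group.sym G (identityʳ _))
  ∏ρ-^ c (x ∷ w) = begin
    ρ x ∙ ∏ρ w ∙ ρ c                        ≈⟨ assoc _ _ _ ⟩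
    ρ x ∙ (∏ρ w ∙ ρ c)                      ≈⟨ ∙-congˡ (∏ρ-^ c w) ⟩
    ρ x ∙ (ρ c ∙ ∏ρ (map (_^ c) w))         ≈⟨ assoc _ _ _ ⟨
    ρ x ∙ ρ c ∙ ∏ρ (map (_^ c) w)           ≈⟨ ∙-congʳ (ρ-^ x c) ⟩
    ρ c ∙ ρ (x ^ c) ∙ ∏ρ (map (_^ c) w)     ≈⟨ assoc _ _ _ ⟩
    ρ c ∙ (ρ (x ^ c) ∙ ∏ρ (map (_^ c) w))   ∎
    where open SetoidReasoning setoid

  ≈ʷ-^ : ∀ c {v w} → v ≈ʷ w → map (_^ c) v ≈ʷ map (_^ c) w
  ≈ʷ-^ c {v} {w} e = ∙-cancelˡ (ρ c) _ _
    (Group.trans G (Group.sym G (∏ρ-^ c v)) (Group.trans G (∙-congʳ e) (∏ρ-^ c w)))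

  ≈ʷ-pair : ∀ {x y x′ y′} → x ∷ y ∷ [] ≈ʷ x′ ∷ y′ ∷ [] → ¬ Distinct x y x′ y′
  ≈ʷ-pair e = ρ-pair _ _ _ _ (Group.trans G (Group.sym G last) (Group.trans G e last))
    where
    last : ∀ {x y} → x ∙ (y ∙ ε) ≈ x ∙ y
    last = ∙-congˡ (identityʳ _)

  ≈ʷ-triple : ∀ {x y z x′ y′ z′} → x ∷ y ∷ z ∷ [] ≈ʷ x′ ∷ y′ ∷ z′ ∷ [] →
              ¬ Distinct₃ x y z x′ y′ z′
  ≈ʷ-triple e = ρ-triple _ _ _ _ _ _ (Group.trans G (Group.sym G last) (Group.trans G e last))
    where
    last : ∀ {x y z} → x ∙ (y ∙ (z ∙ ε)) ≈ x ∙ (y ∙ z)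
    last = ∙-congˡ (∙-congˡ (identityʳ _))

  twisted⇒∼ : ∀ {x y x′ y′} → Twisted (x , y) (x′ , y′) → x ∷ y ∷ [] ∼ x′ ∷ y′ ∷ []
  twisted⇒∼ {x} {y} (i , e) = subst (λ p → x ∷ y ∷ [] ∼ proj₁ p ∷ proj₂ p ∷ []) e (∼-twist (toℕ i) x y [])

  pair⇒∼ : ∀ {x y x′ y′} → Twisted (x , y) (x′ , y′) ⊎ Distinct x y x′ y′ →
           x ∷ y ∷ [] ≈ʷ x′ ∷ y′ ∷ [] → x ∷ y ∷ [] ∼ x′ ∷ y′ ∷ []
  pair⇒∼ (inj₁ twisted) e = twisted⇒∼ twisted
  pair⇒∼ (inj₂ differ)  e = contradiction differ (≈ʷ-pair e)

  -- If every word x y z of types a, b, c is equivalent to one beginning with the standard letter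
  -- of type c, then two words of the same types a, b, … are compared by stripping that letter
  -- from both, until only letters of types a and b are left.
  module Seeded {X : Set} {f : Letter → X} {Q : Pred Letter 0ℓ} (stable : Stable f Q)
    (standard : X → Letter) (f-standard : ∀ {x} → Q x → f (standard (f x)) ≡ f x) {a b : X}
    (strip : ∀ {x y z} → Q x → Q y → Q z → f x ≡ a → f y ≡ b →
             ∃[ v ] x ∷ y ∷ z ∷ [] ∼ standard (f z) ∷ v)
    (base : ∀ {x y x′ y′} → Q x → Q y → Q x′ → Q y′ → f x ≡ a → f y ≡ b → f x′ ≡ a → f y′ ≡ b →
            x ∷ y ∷ [] ≈ʷ x′ ∷ y′ ∷ [] → x ∷ y ∷ [] ∼ x′ ∷ y′ ∷ [])
    where

    stripped : ∀ {c cs w} → All Q w → map f w ↭ a ∷ b ∷ c ∷ cs →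
               ∃[ v ] w ∼ standard c ∷ v × All Q v × map f v ↭ a ∷ b ∷ cs
    stripped {c} {cs} q w↭ with pull stable q w↭
    ... | x , w₁ , fx , e₁ , qx , q₁ , w₁↭ with pull stable q₁ w₁↭
    ... | y , w₂ , fy , e₂ , qy , q₂ , w₂↭ with pull stable q₂ w₂↭
    ... | z , w₃ , refl , e₃ , qz , q₃ , w₃↭ with strip qx qy qz fx fy
    ... | v , e₄ = v ++ w₃ , e , ∼-remove stable q e
        (↭-trans w↭ (↭-trans (shift c (a ∷ b ∷ []) cs)
          (↭-reflexive (cong (_∷ a ∷ b ∷ cs) (sym (f-standard qz))))))
      where e = ∼-trans e₁ (∼-trans (prepend x (∼-trans e₂ (prepend y e₃))) (∼-++ e₄ w₃))

    two : ∀ {w} → All Q w → map f w ↭ a ∷ b ∷ [] →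
          ∃[ x ] ∃[ y ] Q x × Q y × f x ≡ a × f y ≡ b × w ∼ x ∷ y ∷ []
    two q w↭ with pull stable q w↭
    ... | x , w₁ , fx , e₁ , qx , q₁ , w₁↭ with pull stable q₁ w₁↭
    ... | y , w₂ , fy , e₂ , qy , q₂ , w₂↭ with map-↭-[] w₂↭
    ... | refl = x , y , qx , qy , fx , fy , ∼-trans e₁ (prepend x e₂)

    ≈ʷ⇒∼ : ∀ cs {w w′} → All Q w → All Q w′ → map f w ↭ a ∷ b ∷ cs → map f w′ ↭ a ∷ b ∷ cs → w ≈ʷ w′ → w ∼ w′
    ≈ʷ⇒∼ [] q q′ w↭ w′↭ e with two q w↭ | two q′ w′↭
    ... | x , y , qx , qy , fx , fy , d | x′ , y′ , qx′ , qy′ , fx′ , fy′ , d′ =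
      ∼-trans d (∼-trans (base qx qy qx′ qy′ fx fy fx′ fy′ (∼-≈ʷ d d′ e)) (∼-sym d′))
    ≈ʷ⇒∼ (c ∷ cs) q q′ w↭ w′↭ e with stripped q w↭ | stripped q′ w′↭
    ... | v , d , p , v↭ | v′ , d′ , p′ , v′↭ = ∼-join d d′ (≈ʷ⇒∼ cs p p′ v↭ v′↭ (∼-cancel d d′ e))

  edges-≈ʷ⇒∼ : ∀ {a b} → a ≢ b → ∀ cs {w w′} → All IsEdge w → All IsEdge w′ →
          map axis w ↭ a ∷ b ∷ cs → map axis w′ ↭ a ∷ b ∷ cs → w ≈ʷ w′ → w ∼ w′
  edges-≈ʷ⇒∼ {a} {b} a≢b = Seeded.≈ʷ⇒∼ axis-stable [ edge , rot 0F ]′ (λ { (e , refl) → std-axis e }) strip base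
    where
    strip : ∀ {x y z} → IsEdge x → IsEdge y → IsEdge z → axis x ≡ a → axis y ≡ b →
            ∃[ v ] x ∷ y ∷ z ∷ [] ∼ [ edge , rot 0F ]′ (axis z) ∷ v
    strip (e , refl) (f , refl) (g , refl) p q with edges-reach e f g
    ... | inj₁ e≡f = contradiction (trans (sym p) (trans e≡f q)) a≢b
    ... | inj₂ r   with reach-∼ r
    ...   | v , d , _ = v , d
    base : ∀ {x y x′ y′} → IsEdge x → IsEdge y → IsEdge x′ → IsEdge y′ → axis x ≡ a → axis y ≡ b →
           axis x′ ≡ a → axis y′ ≡ b → x ∷ y ∷ [] ≈ʷ x′ ∷ y′ ∷ [] → x ∷ y ∷ [] ∼ x′ ∷ y′ ∷ []
    base (e , refl) (f , refl) (e′ , refl) (f′ , refl) p q p′ q′ with edge-pairs e f e′ f′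
    ... | inj₁ e≡f              = contradiction (trans (sym p) (trans e≡f q)) a≢b
    ... | inj₂ (inj₁ e≢e′)        = contradiction (trans p (sym p′)) e≢e′
    ... | inj₂ (inj₂ (inj₁ f≢f′)) = contradiction (trans q (sym q′)) f≢f′
    ... | inj₂ (inj₂ (inj₂ r))    = pair⇒∼ r

  all-⊤ : ∀ w → All (λ (_ : Letter) → ⊤) w
  all-⊤ = All.universal λ _ → tt

  kind⇒edge : ∀ {x} → kind x ≡ nothing → ∃[ e ] x ≡ edge e
  kind⇒edge {edge e} refl = e , refl

  mixed-≈ʷ⇒∼ : ∀ {k} cs {w w′} → map kind w ↭ nothing ∷ just k ∷ cs → map kind w′ ↭ nothing ∷ just k ∷ cs →
          w ≈ʷ w′ → w ∼ w′
  mixed-≈ʷ⇒∼ {k} cs = Seeded.≈ʷ⇒∼ kind-stable standard (λ {x} _ → kind-standard x) (λ _ _ _ → strip)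
                 (λ _ _ _ _ → base) cs (all-⊤ _) (all-⊤ _)
    where
    kind-standard : ∀ x → kind (standard (kind x)) ≡ kind x
    kind-standard (edge e)  = refl
    kind-standard (rot k v) = refl
    strip : ∀ {x y z} → kind x ≡ nothing → kind y ≡ just k → ∃[ v ] x ∷ y ∷ z ∷ [] ∼ standard (kind z) ∷ v
    strip {z = z} p q with kind⇒edge p | kind⇒rot q
    ... | e , refl | v , refl with reach-∼ (mixed-reach e k v z)
    ...   | u , d , _ = u , d
    base : ∀ {x y x′ y′} → kind x ≡ nothing → kind y ≡ just k → kind x′ ≡ nothing → kind y′ ≡ just k →
           x ∷ y ∷ [] ≈ʷ x′ ∷ y′ ∷ [] → x ∷ y ∷ [] ∼ x′ ∷ y′ ∷ []
    base p q p′ q′ with kind⇒edge p | kind⇒rot q | kind⇒edge p′ | kind⇒rot q′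
    ... | e , refl | v , refl | e′ , refl | v′ , refl = pair⇒∼ (mixed-pairs k e v e′ v′)

  Leads : Kind → Vertex → List Letter → Set
  Leads k u w = ∃[ v ] w ∼ rot k u ∷ v × ¬ Coaxial v

  leads-^ : ∀ {k u w} c → Leads k (u ▹ c) (map (_^ c) w) → Leads k u w
  leads-^ {k} {u} {w} c (v , d , ¬coaxial) = map (_^ opposite c) v
    , subst₂ (λ w u → w ∼ rot k u ∷ map (_^ opposite c) v) (map-opposite-^ c w) (▹-cancel u c)
        (∼-^ (opposite c) d)
    , λ p → ¬coaxial (subst Coaxial (map-^-opposite c v) (coaxial-^ c p))

  -- Two such words of kind k have a common leading letter, as there are four vertices.
  AlmostLeads : Kind → List Letter → Set
  AlmostLeads k w = ∃[ u₀ ] ∀ u → u ≡ u₀ ⊎ Leads k u w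

  almostLeads-^ : ∀ {k w} c → AlmostLeads k (map (_^ c) w) → AlmostLeads k w
  almostLeads-^ {k} {w} c (u₀ , p) = u₀ ▹ opposite c , λ u →
    Sum.map (λ e → trans (sym (▹-cancel u c)) (cong (_▹ opposite c) e)) (leads-^ c) (p (u ▹ c))

  almostLeads : ∀ k l m n {a b} c d → a ≢ b → AlmostLeads k (rot k a ∷ rot l b ∷ rot m c ∷ rot n d ∷ [])
  almostLeads k l m n {a} {b} c d a≢b with doubly-transitive a b
  ... | inj₁ a≡b = contradiction a≡b a≢b
  ... | inj₂ (x , y , p , q) = almostLeads-^ x (almostLeads-^ y
    (subst₂ (λ a b → AlmostLeads k (rot k a ∷ rot l b ∷ rot m (c ▹ x ▹ y) ∷ rot n (d ▹ x ▹ y) ∷ []))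
      (sym p) (sym q)
      (let u₀ , r = quadruples-reach k l m n (c ▹ x ▹ y) (d ▹ x ▹ y) in u₀ , λ u → Sum.map₂ reach-∼ (r u))))

  -- For three letters, words that cannot be led by the same letter have different products.
  SeparatedWord : Kind → Kind → Kind → List Letter → Set
  SeparatedWord k l m w = ∀ b₁ → Leads k b₁ w ⊎
    (∀ b₂ b₃ → b₂ ≢ b₃ → ¬ w ≈ʷ rot k b₁ ∷ rot l b₂ ∷ rot m b₃ ∷ [])

  separated-^ : ∀ {k l m w} c → SeparatedWord k l m (map (_^ c) w) → SeparatedWord k l m w
  separated-^ {k} {l} {m} {w} c p b₁ = Sum.map (leads-^ c)
    (λ f b₂ b₃ b₂≢b₃ e → f (b₂ ▹ c) (b₃ ▹ c) (b₂≢b₃ ∘ ▹-injective c)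
      (≈ʷ-^ c {w} {rot k b₁ ∷ rot l b₂ ∷ rot m b₃ ∷ []} e))
    (p (b₁ ▹ c))

  separated⇒ : ∀ {k l m a₁ a₂ a₃} → Separated k l m a₁ a₂ a₃ →
               SeparatedWord k l m (rot k a₁ ∷ rot l a₂ ∷ rot m a₃ ∷ [])
  separated⇒ p b₁ = Sum.map reach-∼
    (λ avoids b₂ b₃ b₂≢b₃ e → [ b₂≢b₃ , ≈ʷ-triple e ]′ (avoids b₂ b₃)) (p b₁)

  separated : ∀ k l m a₁ a₂ a₃ → ¬ Coaxial (rot k a₁ ∷ rot l a₂ ∷ rot m a₃ ∷ []) →
              SeparatedWord k l m (rot k a₁ ∷ rot l a₂ ∷ rot m a₃ ∷ [])
  separated k l m a₁ a₂ a₃ ¬coaxial with doubly-transitive a₁ a₂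
  ... | inj₂ (x , y , p , q) = separated-^ x (separated-^ y
    (subst₂ (λ a b → SeparatedWord k l m (rot k a ∷ rot l b ∷ rot m (a₃ ▹ x ▹ y) ∷ [])) (sym p) (sym q)
      (separated⇒ {a₁ = 0F} {1F} (proj₁ (triples-separated k l m) (a₃ ▹ x ▹ y)))))
  ... | inj₁ refl with doubly-transitive a₁ a₃
  ...   | inj₁ refl = contradiction (inj₂ a₁ , refl ∷ refl ∷ refl ∷ []) ¬coaxial
  ...   | inj₂ (x , y , p , q) = separated-^ x (separated-^ y
    (subst₂ (λ a b → SeparatedWord k l m (rot k a ∷ rot l a ∷ rot m b ∷ [])) (sym p) (sym q)
      (separated⇒ {a₁ = 0F} {0F} {1F} (proj₂ (triples-separated k l m)))))

  opaque
    ∼-kinds : ∀ {v w as} → v ∼ w → map kind v ↭ as → map kind w ↭ as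
    ∼-kinds e v↭ = ↭-trans (↭-sym (∼-↭ kind-stable e (all-⊤ _))) v↭

  opaque
    pull-rot : ∀ {w k as} → map kind w ↭ just k ∷ as → ∃[ a ] ∃[ v ] w ∼ rot k a ∷ v × map kind v ↭ as
    pull-rot {w} w↭ with pull kind-stable (all-⊤ w) w↭
    ... | x , v , kx , e , _ , _ , v↭ with kind⇒rot kx
    ...   | a , refl = a , v , e , v↭

  opaque
    pull-rot₂ : ∀ {w k l} → map kind w ↭ just k ∷ just l ∷ [] → ∃[ a ] ∃[ b ] w ∼ rot k a ∷ rot l b ∷ []
    pull-rot₂ w↭ with pull-rot w↭
    ... | a , v , e , v↭ with pull-rot v↭
    ...   | b , v′ , e′ , v′↭ with map-↭-[] v′↭
    ...     | refl = a , b , ∼-trans e (prepend _ e′)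

  opaque
    pull-rot₃ : ∀ {w k l m} → map kind w ↭ just k ∷ just l ∷ just m ∷ [] →
                ∃[ a ] ∃[ b ] ∃[ c ] w ∼ rot k a ∷ rot l b ∷ rot m c ∷ []
    pull-rot₃ w↭ with pull-rot w↭
    ... | a , v , e , v↭ with pull-rot₂ v↭
    ...   | b , c , e′ = a , b , c , ∼-trans e (prepend _ e′)

  opaque
    all-rot : ∀ {w} ks → map kind w ↭ map just ks → All IsRot w
    all-rot ks w↭ = All.map (λ (k , e) → k , kind⇒rot e)
      (All.map⁻ (All-resp-↭ {P = λ c → ∃[ k ] c ≡ just k} (↭-sym w↭)
        (All.map⁺ (All.universal (λ k → k , refl) ks))))

  opaque
    strip-rot : ∀ {k l m n ks w} → map kind w ↭ map just (k ∷ l ∷ m ∷ n ∷ ks) → ¬ Coaxial w → AlmostLeads k w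
    strip-rot {k} {l} {m} {n} {ks} {w} w↭ ¬coaxial with pull-rot w↭
    -- A letter off the axis of the first one is brought to the second place, as the check on
    -- quadruples demands.
    ... | a , w₁ , e₁ , w₁↭ with non-coaxial (¬coaxial ∘ coaxial-∼ (∼-sym e₁))
    ... | y , w₂ , y≢a , e₂ with ∼-kinds e₂ w₁↭
    ... | w₂↭ with ↭-length w₂↭ | all-rot (l ∷ m ∷ n ∷ ks) w₂↭
    ... | len | (l′ , b , refl) ∷ rots = lengthen w₂ len rots e₂
      where
      lengthen : ∀ w₂ → length (kind (rot l′ b) ∷ map kind w₂) ≡ length (map just (l ∷ m ∷ n ∷ ks)) →
                 All IsRot w₂ →
                 w₁ ∼ rot l′ b ∷ w₂ → AlmostLeads k w
      -- The length forces two more letters. The braid acts on the first four only, and a remainder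
      -- that is non-coaxial on a prefix is non-coaxial as a whole.
      lengthen (_ ∷ _ ∷ w₃) _ ((m′ , c , refl) ∷ (n′ , d , refl) ∷ _) e₂
        with almostLeads k l′ m′ n′ c d (λ a≡b → y≢a (cong inj₂ (sym a≡b)))
      ... | u₀ , leads = u₀ , λ u → Sum.map₂
        (λ (v , e , ¬coaxial) → v ++ w₃ , ∼-trans e₁ (∼-trans (prepend _ e₂) (∼-++ e w₃)) ,
          λ (a , p) → ¬coaxial (a , All.++⁻ˡ v p))
        (leads u)

  opaque
    rotation-pairs : ∀ {k l w w′} → map kind w ↭ just k ∷ just l ∷ [] → map kind w′ ↭ just k ∷ just l ∷ [] →
                     ¬ Coaxial w → ¬ Coaxial w′ → w ≈ʷ w′ → w ∼ w′
    rotation-pairs {k} {l} w↭ w′↭ ¬coaxial ¬coaxial′ e with pull-rot₂ w↭ | pull-rot₂ w′↭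
    ... | a , b , d | a′ , b′ , d′ with rot-pairs k l a b a′ b′
    ... | inj₁ refl        = contradiction (coaxial-∼ (∼-sym d) (inj₂ a , refl ∷ refl ∷ [])) ¬coaxial
    ... | inj₂ (inj₁ refl) = contradiction (coaxial-∼ (∼-sym d′) (inj₂ a′ , refl ∷ refl ∷ [])) ¬coaxial′
    ... | inj₂ (inj₂ r)    = ∼-trans d (∼-trans (pair⇒∼ r (∼-≈ʷ d d′ e)) (∼-sym d′))

  opaque
    -- If the last two letters share a vertex, a full twist of the first two moves the second one
    -- away and keeps the kinds.
    pull-rot₃′ : ∀ {w k l m} → map kind w ↭ just k ∷ just l ∷ just m ∷ [] → ¬ Coaxial w →
                 ∃[ a ] ∃[ b ] ∃[ c ] b ≢ c × w ∼ rot k a ∷ rot l b ∷ rot m c ∷ []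
    pull-rot₃′ {w} {k} {l} {m} w↭ ¬coaxial with pull-rot₃ w↭
    ... | a , b , c , e with b Fin.≟ c
    ...   | no b≢c   = a , b , c , b≢c , e
    ...   | yes refl with full-twist-moves k l a b
    ...     | inj₁ refl  = contradiction (coaxial-∼ (∼-sym e) (inj₂ a , refl ∷ refl ∷ refl ∷ [])) ¬coaxial
    ...     | inj₂ moved = _ , _ , c , moved , ∼-trans e (∼-twist 2 (rot k a) (rot l b) (rot m c ∷ []))

  opaque
    rotation-step : ∀ {k l m n ks} → (let ks′ = l ∷ m ∷ n ∷ ks) →
      (∀ {w w′} → map kind w ↭ map just ks′ → map kind w′ ↭ map just ks′ →
        ¬ Coaxial w → ¬ Coaxial w′ → w ≈ʷ w′ → w ∼ w′) →
      ∀ {w w′} → map kind w ↭ map just (k ∷ ks′) → map kind w′ ↭ map just (k ∷ ks′) →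
      ¬ Coaxial w → ¬ Coaxial w′ → w ≈ʷ w′ → w ∼ w′
    rotation-step rotations w↭ w′↭ ¬coaxial ¬coaxial′ e with strip-rot w↭ ¬coaxial | strip-rot w′↭ ¬coaxial′
    ... | u₀ , leads | u₀′ , leads′ with third-vertex u₀ u₀′
    ... | u , u≢u₀ , u≢u₀′ with leads u | leads′ u
    ... | inj₁ u≡u₀ | _          = contradiction u≡u₀ u≢u₀
    ... | inj₂ _    | inj₁ u≡u₀′ = contradiction u≡u₀′ u≢u₀′
    ... | inj₂ (v , d , ¬v) | inj₂ (v′ , d′ , ¬v′) = ∼-join d d′
      (rotations (proj₂ (∼-remove kind-stable (all-⊤ _) d w↭))
        (proj₂ (∼-remove kind-stable (all-⊤ _) d′ w′↭)) ¬v ¬v′ (∼-cancel d d′ e))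

  opaque
    rotations-≈ʷ⇒∼ : ∀ ks {w w′} → map kind w ↭ map just ks → map kind w′ ↭ map just ks →
                ¬ Coaxial w → ¬ Coaxial w′ → w ≈ʷ w′ → w ∼ w′
    rotations-≈ʷ⇒∼ [] w↭ _ ¬coaxial _ _ with map-↭-[] w↭
    ... | refl = contradiction (inj₂ 0F , []) ¬coaxial
    rotations-≈ʷ⇒∼ (k ∷ []) w↭ _ ¬coaxial _ _ with pull-rot w↭
    ... | a , v , e , v↭ with map-↭-[] v↭
    ...   | refl = contradiction (coaxial-∼ (∼-sym e) (inj₂ a , refl ∷ [])) ¬coaxial
    rotations-≈ʷ⇒∼ (k ∷ l ∷ []) = rotation-pairs
    -- The second word is put into the form of the rival word: its head either leads the first word
    -- too, or the products differ.
    rotations-≈ʷ⇒∼ (k ∷ l ∷ m ∷ []) w↭ w′↭ ¬coaxial ¬coaxial′ e with pull-rot₃ w↭ | pull-rot₃′ w′↭ ¬coaxial′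
    ... | a₁ , a₂ , a₃ , d | b₁ , b₂ , b₃ , b₂≢b₃ , d′
      with separated k l m a₁ a₂ a₃ (¬coaxial ∘ coaxial-∼ (∼-sym d)) b₁
    ... | inj₂ avoids = contradiction (∼-≈ʷ d d′ e) (avoids b₂ b₃ b₂≢b₃)
    ... | inj₁ (v , d″ , ¬coaxial-v) = ∼-join (∼-trans d d″) d′
      (rotation-pairs (proj₂ (∼-remove kind-stable (all-⊤ _) (∼-trans d d″) w↭)) ↭-refl ¬coaxial-v
        (λ { (_ , refl ∷ b₃≡ ∷ []) → b₂≢b₃ (sym (⊎.inj₂-injective b₃≡)) })
        (∼-cancel (∼-trans d d″) d′ e))
    rotations-≈ʷ⇒∼ (k ∷ ks@(_ ∷ _ ∷ _ ∷ _)) = rotation-step (rotations-≈ʷ⇒∼ ks)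

  opaque
    mixed-kinds : ∀ {w} → Any IsEdge w → Any (λ x → ¬ IsEdge x) w →
                  ∃[ k ] ∃[ cs ] map kind w ↭ nothing ∷ just k ∷ cs
    mixed-kinds edge∈w rot∈w with front edge∈w
    ... | _ , v , (e , refl) , d
      with ∈⇒↭ (kind∈v (∈-resp-↭ (∼-↭ kind-stable d (all-⊤ _)) (proj₂ (rot-kind rot∈w))))
      where
      rot-kind : ∀ {w} → Any (λ x → ¬ IsEdge x) w → ∃[ k ] just k List.∈ map kind w
      rot-kind (here {edge e} ¬edge)  = contradiction (e , refl) ¬edge
      rot-kind (here {rot k v} _)     = k , here refl
      rot-kind (there any)            = let k , k∈ = rot-kind any in k , there k∈
      kind∈v : ∀ {k : Kind} {as : List (Maybe Kind)} → just k List.∈ nothing ∷ as → just k List.∈ as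
      kind∈v (there k∈) = k∈
    ...   | cs , v↭ = _ , cs , ↭-trans (∼-↭ kind-stable d (all-⊤ _)) (prep nothing v↭)

  just-kinds : ∀ {w} → All (λ x → ¬ IsEdge x) w → ∃[ ks ] map kind w ≡ map just ks
  just-kinds []                         = [] , refl
  just-kinds {edge e ∷ w}  (¬edge ∷ _)  = contradiction (e , refl) ¬edge
  just-kinds {rot k v ∷ w} (_ ∷ p)      = let ks , e = just-kinds p in k ∷ ks , cong (just k ∷_) e

  -- An axis is of type `inj₁` exactly for reflections of order 2.
  edge-axes : ∀ {w w′} → All IsEdge w → map axis w ↭ map axis w′ → All IsEdge w′
  edge-axes p e = All.map (λ {x} → from-axis x)
    (All.map⁻ (All-resp-↭ {P = λ a → ∃[ e ] a ≡ inj₁ e} e (All.map⁺ (All.map to-axis p))))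
    where
    to-axis : ∀ {x} → IsEdge x → ∃[ e ] axis x ≡ inj₁ e
    to-axis (e , refl) = _ , refl
    from-axis : ∀ x → ∃[ e ] axis x ≡ inj₁ e → IsEdge x
    from-axis (edge e) _ = e , refl

  -- `invariants` ranges over all stable labels, so that each case chooses its own.
  module _ {w w′} (w≈w′ : w ≈ʷ w′)
    (invariants : ∀ {X : Set} {f : Letter → X} {Q} → Stable f Q → All Q w → map f w ↭ map f w′)
    (coaxial′ : Coaxial w′ → Coaxial w) where

    private
      kinds : map kind w ↭ map kind w′
      kinds = invariants kind-stable (all-⊤ w)

    coaxial-case : Coaxial w → w ∼ w′
    coaxial-case (a , p) = ↭⇒∼ p (subst₂ _↭_ (map-id w) (map-id w′) (invariants (coaxial-stable a) p))

    edge-case : ∀ {x y v} → axis y ≢ axis x → w ∼ x ∷ y ∷ v → All IsEdge w → w ∼ w′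
    edge-case {v = v} y≢x d p =
      edges-≈ʷ⇒∼ (y≢x ∘ sym) (map axis v) p (edge-axes p axes) axes₂ (↭-trans (↭-sym axes) axes₂) w≈w′
      where
      axes  = invariants axis-stable p
      axes₂ = ∼-↭ axis-stable d p

    mixed-case : Any IsEdge w → Any (λ x → ¬ IsEdge x) w → w ∼ w′
    mixed-case p q = let k , cs , e = mixed-kinds p q in mixed-≈ʷ⇒∼ cs e (↭-trans (↭-sym kinds) e) w≈w′

    rotation-case : ¬ Coaxial w → All (λ x → ¬ IsEdge x) w → w ∼ w′
    rotation-case ¬coaxial p = let ks , e = just-kinds p in
      rotations-≈ʷ⇒∼ ks (↭-reflexive e) (↭-trans (↭-sym kinds) (↭-reflexive e)) ¬coaxial (¬coaxial ∘ coaxial′) w≈w′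

    classification : w ∼ w′
    classification with coaxial? w
    ... | yes coaxial = coaxial-case coaxial
    ... | no ¬coaxial with all? isEdge? w | any? isEdge? w
    ...   | no ¬edges | yes p = mixed-case p (All.¬All⇒Any¬ isEdge? w ¬edges)
    ...   | _         | no ¬p = rotation-case ¬coaxial (All.¬Any⇒All¬ w ¬p)
    ...   | yes edges | yes _ = let x , y , v , y≢x , d = non-coaxial-pair ¬coaxial in edge-case y≢x d edges

-- Factorizations in a group

module HurwitzInvariants (G : Group 0ℓ 0ℓ) where
  open Group G hiding (inverse; identity) renaming (refl to ≈-refl; sym to ≈-sym; trans to ≈-trans)
  open GroupProperties G
  open Factorizations G
  open Membership setoid using () renaming (_∈_ to _∈ᵛ_)
  open VecEquality setoid using (_≋_; []; _∷_; ≋-refl; ≋-sym)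

  private variable
    n : ℕ
    T U V : Vec Carrier n

  generated-⊆ : ∀ {X Y : Pred Carrier 0ℓ} → X ⊆ Generated Y → Generated X ⊆ Generated Y
  generated-⊆ X⊆ (generator x∈)  = X⊆ x∈
  generated-⊆ X⊆ identity        = identity
  generated-⊆ X⊆ (product g h)   = product (generated-⊆ X⊆ g) (generated-⊆ X⊆ h)
  generated-⊆ X⊆ (inverse g)     = inverse (generated-⊆ X⊆ g)
  generated-⊆ X⊆ (respects e g)  = respects e (generated-⊆ X⊆ g)

  tail-⊆ : ∀ {x} → ⟨ T ⟩ ⊆ ⟨ x ∷ T ⟩
  tail-⊆ = generated-⊆ (generator ∘ Vec.there)

  head-∈ : ∀ {x} → x ∈ ⟨ x ∷ T ⟩
  head-∈ = generator (Vec.here ≈-refl)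

  ∷-⊆ : ∀ {x} {H : Pred Carrier 0ℓ} → x ∈ Generated H → ⟨ T ⟩ ⊆ Generated H → ⟨ x ∷ T ⟩ ⊆ Generated H
  ∷-⊆ {T = T} {x} {H} x∈ T⊆ = generated-⊆ entries
    where
    entries : (_∈ᵛ (x ∷ T)) ⊆ Generated H
    entries (Vec.here y≈x)  = respects (≈-sym y≈x) x∈
    entries (Vec.there y∈T) = T⊆ (generator y∈T)

  conjugacy-mono : ∀ {X Y : Pred Carrier 0ℓ} → Generated X ⊆ Generated Y →
    ∀ {x y} → Setoid._≈_ (conjugacy X) x y → Setoid._≈_ (conjugacy Y) x y
  conjugacy-mono X⊆ (h , h∈ , e) = h , X⊆ h∈ , e

  ≈⇒conjugate : ∀ {X : Pred Carrier 0ℓ} {x y} → x ≈ y → Setoid._≈_ (conjugacy X) x y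
  ≈⇒conjugate {X} {x} x≈y with Setoid.refl (conjugacy X) {x}
  ... | h , h∈ , e = h , h∈ , ≈-trans e x≈y

  infix 4 _≅_
  _≅_ : Vec Carrier n → Vec Carrier n → Set
  T ≅ V = ∏ T ≈ ∏ V × ⟨ T ⟩ ≐ ⟨ V ⟩ × SameClasses T V

  -- `SameClasses` refers to the group generated by its first argument, so the conjugacies are
  -- transported along `T⊆V`.
  ≅-sym : T ≅ V → V ≅ T
  ≅-sym {T = T} (e , (T⊆V , V⊆T) , p) = ≈-sym e , (V⊆T , T⊆V) ,
    Homogeneous.map (conjugacy-mono T⊆V) 
      (Homogeneous.sym (λ {x} {y} → Setoid.sym (conjugacy (_∈ᵛ T)) {x} {y}) p)

  ≅-trans : T ≅ U → U ≅ V → T ≅ V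
  ≅-trans (e , (T⊆U , U⊆T) , p) (e′ , (U⊆V , V⊆U) , p′) =
    ≈-trans e e′ , (U⊆V ∘ T⊆U , U⊆T ∘ V⊆U) , Homogeneous.trans p (Homogeneous.map (conjugacy-mono U⊆T) p′)

  ∏-cong : {T V : Vec Carrier n} → T ≋ V → ∏ T ≈ ∏ V
  ∏-cong []      = ≈-refl
  ∏-cong (e ∷ p) = ∙-cong e (∏-cong p)

  ≋⇒⊆ : {T V : Vec Carrier n} → T ≋ V → ⟨ T ⟩ ⊆ ⟨ V ⟩
  ≋⇒⊆ []      = λ g → g
  ≋⇒⊆ (e ∷ p) = ∷-⊆ (generator (Vec.here e)) (tail-⊆ ∘ ≋⇒⊆ p)

  ≋⇒conjugate : ∀ {X : Pred Carrier 0ℓ} {T V : Vec Carrier n} → T ≋ V →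
                Pointwise (Setoid._≈_ (conjugacy X)) (toList T) (toList V)
  ≋⇒conjugate []      = []
  ≋⇒conjugate (e ∷ p) = ≈⇒conjugate e ∷ ≋⇒conjugate p

  ≋⇒≅ : T ≋ V → T ≅ V
  ≋⇒≅ p = ∏-cong p , (≋⇒⊆ p , ≋⇒⊆ (≋-sym p)) , Homogeneous.refl (≋⇒conjugate p)

  ≅-∷ : ∀ x → T ≅ V → x ∷ T ≅ x ∷ V
  ≅-∷ x (e , (T⊆V , V⊆T) , p) =
      ∙-congˡ e
    , (∷-⊆ head-∈ (tail-⊆ ∘ T⊆V) , ∷-⊆ head-∈ (tail-⊆ ∘ V⊆T))
    , Homogeneous.prep (≈⇒conjugate ≈-refl) (Homogeneous.map (conjugacy-mono tail-⊆) p)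

  -- The entry `y` itself realises the conjugacy of `x` with its image, and conjugating back by it
  -- recovers `x` in the group generated afterwards.
  ≅-swap : ∀ x y (T : Vec Carrier n) → x ∷ y ∷ T ≅ y ∷ y ⁻¹ ∙ x ∙ y ∷ T
  ≅-swap x y T =
      ≈-sym product≈
    , ( ∷-⊆ (respects unconjugate (product (product y∈ z∈) (inverse y∈))) (∷-⊆ y∈ (tail-⊆ ∘ tail-⊆))
      , ∷-⊆ (tail-⊆ head-∈) (∷-⊆ (product (product (inverse (tail-⊆ head-∈)) head-∈) (tail-⊆ head-∈))
          (tail-⊆ ∘ tail-⊆)))
    , Homogeneous.swap (y , tail-⊆ head-∈ , ≈-refl) (≈⇒conjugate ≈-refl)
        (Homogeneous.refl (≋⇒conjugate (≋-refl {x = T})))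
    where
    open SetoidReasoning setoid
    y∈ : y ∈ ⟨ y ∷ y ⁻¹ ∙ x ∙ y ∷ T ⟩
    y∈ = head-∈
    z∈ : y ⁻¹ ∙ x ∙ y ∈ ⟨ y ∷ y ⁻¹ ∙ x ∙ y ∷ T ⟩
    z∈ = tail-⊆ head-∈
    y∙z : y ∙ (y ⁻¹ ∙ x ∙ y) ≈ x ∙ y
    y∙z = ≈-trans (∙-congˡ (assoc _ _ _)) (\\-leftDividesˡ y (x ∙ y))
    unconjugate : y ∙ (y ⁻¹ ∙ x ∙ y) ∙ y ⁻¹ ≈ x
    unconjugate = ≈-trans (∙-congʳ y∙z) (//-rightDividesʳ y x)
    product≈ : y ∙ (y ⁻¹ ∙ x ∙ y ∙ ∏ T) ≈ x ∙ (y ∙ ∏ T)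
    product≈ = begin
      y ∙ (y ⁻¹ ∙ x ∙ y ∙ ∏ T)    ≈⟨ assoc _ _ _ ⟨
      y ∙ (y ⁻¹ ∙ x ∙ y) ∙ ∏ T    ≈⟨ ∙-congʳ y∙z ⟩
      x ∙ y ∙ ∏ T                 ≈⟨ assoc _ _ _ ⟩
      x ∙ (y ∙ ∏ T)               ∎

  ≅-σ : ∀ (i : Fin (pred n)) (T : Vec Carrier n) → T ≅ σ i T
  ≅-σ {suc (suc n)} zero    (x ∷ y ∷ T) = ≅-swap x y T
  ≅-σ {suc (suc n)} (suc i) (x ∷ T)     = ≅-∷ x (≅-σ i T)

  ⇝⇒≅ : {T V : Vec Carrier n} → T ⇝ V → T ≅ V
  ⇝⇒≅ ([] , e)               = ≋⇒≅ e
  ⇝⇒≅ {T = T} (i ∷ is , e)   = ≅-trans (≅-σ i T) (⇝⇒≅ (is , e))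

  ≃⇒≅ : {T V : Vec Carrier n} → T ≃ V → T ≅ V
  ≃⇒≅ (inj₁ e) = ⇝⇒≅ e
  ≃⇒≅ (inj₂ e) = ≅-sym (⇝⇒≅ e)

  foldl-σ-∷ : ∀ x (T : Vec Carrier n) is → ∃[ js ] foldl (flip σ) (x ∷ T) js ≡ x ∷ foldl (flip σ) T is
  foldl-σ-∷ x T               []       = [] , ≡.refl
  foldl-σ-∷ {suc (suc n)} x T (i ∷ is) = let js , e = foldl-σ-∷ x (σ i T) is in suc i ∷ js , e

  -- The centralizer of `g` is a subgroup. Applied twice, this shows that commuting generators
  -- generate an abelian group.
  centralized : ∀ {X : Pred Carrier 0ℓ} {g} → (∀ {x} → x ∈ X → x ∙ g ≈ g ∙ x) →
                ∀ {h} → h ∈ Generated X → h ∙ g ≈ g ∙ h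
  centralized c (generator x∈) = c x∈
  centralized c identity = ≈-trans (identityˡ _) (≈-sym (identityʳ _))
  centralized {g = g} c (product {h} {k} h∈ k∈) = begin
    h ∙ k ∙ g     ≈⟨ assoc _ _ _ ⟩
    h ∙ (k ∙ g)   ≈⟨ ∙-congˡ (centralized c k∈) ⟩
    h ∙ (g ∙ k)   ≈⟨ assoc _ _ _ ⟨
    h ∙ g ∙ k     ≈⟨ ∙-congʳ (centralized c h∈) ⟩
    g ∙ h ∙ k     ≈⟨ assoc _ _ _ ⟩
    g ∙ (h ∙ k)   ∎
    where open SetoidReasoning setoid
  centralized {g = g} c (inverse {h} h∈) = ∙-cancelˡ h _ _ (begin
    h ∙ (h ⁻¹ ∙ g)      ≈⟨ \\-leftDividesˡ h g ⟩
    g                   ≈⟨ //-rightDividesʳ h g ⟨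
    g ∙ h ∙ h ⁻¹        ≈⟨ ∙-congʳ (centralized c h∈) ⟨
    h ∙ g ∙ h ⁻¹        ≈⟨ assoc _ _ _ ⟩
    h ∙ (g ∙ h ⁻¹)      ∎)
    where open SetoidReasoning setoid
  centralized c (respects e h∈) = ≈-trans (∙-congʳ (≈-sym e)) (≈-trans (centralized c h∈) (∙-congˡ e))

-- Factorizations labelled by words

module Labelled (G : Group 0ℓ 0ℓ) (ρ : Letter → Group.Carrier G)
  (labelling : FaithfulLabelling G ρ) where
  open Group G hiding (inverse; identity) renaming (refl to ≈-refl; sym to ≈-sym; trans to ≈-trans)
  open GroupProperties G
  open Factorizations G
  open Membership setoid using () renaming (_∈_ to _∈ᵛ_)
  open VecEquality setoid using (_≋_; []; _∷_)
  open HurwitzInvariants G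
  open FaithfulLabelling labelling
  open Classification G ρ labelling

  private variable
    n : ℕ

  Labels : Vec Carrier n → List Letter → Set
  Labels T w = Pointwise (λ g x → g ≈ ρ x) (toList T) w

  labels-∏ : ∀ (T : Vec Carrier n) {w} → Labels T w → ∏ T ≈ ∏ρ w
  labels-∏ []      []      = ≈-refl
  labels-∏ (g ∷ T) (e ∷ p) = ∙-cong e (labels-∏ T p)

  labels-≋ : ∀ (T V : Vec Carrier n) {w} → Labels T w → Labels V w → T ≋ V
  labels-≋ []      []      []      []      = []
  labels-≋ (g ∷ T) (h ∷ V) (e ∷ p) (d ∷ q) = ≈-trans e (≈-sym d) ∷ labels-≋ T V p q

  labels-injective : ∀ {gs v w} → Pointwise (λ g x → g ≈ ρ x) gs v → Pointwise (λ g x → g ≈ ρ x) gs w → v ≡ w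
  labels-injective []      []      = ≡.refl
  labels-injective (e ∷ p) (d ∷ q) = ≡.cong₂ _∷_ (ρ-injective (≈-trans (≈-sym e) d)) (labels-injective p q)

  ρ-conjugate : ∀ {g h x y} → g ≈ ρ x → h ≈ ρ y → h ⁻¹ ∙ g ∙ h ≈ ρ (x ^ y)
  ρ-conjugate {g} {h} {x} {y} g≈ h≈ = begin
    h ⁻¹ ∙ g ∙ h                ≈⟨ assoc _ _ _ ⟩
    h ⁻¹ ∙ (g ∙ h)              ≈⟨ ∙-congˡ (≈-trans (∙-cong g≈ h≈) (ρ-^ x y)) ⟩
    h ⁻¹ ∙ (ρ y ∙ ρ (x ^ y))    ≈⟨ ∙-congˡ (∙-congʳ h≈) ⟨
    h ⁻¹ ∙ (h ∙ ρ (x ^ y))      ≈⟨ \\-leftDividesʳ h _ ⟩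
    ρ (x ^ y)                   ∎
    where open SetoidReasoning setoid

  ∼⇒moves : ∀ {v w} → v ∼ w → (T : Vec Carrier n) → Labels T v → ∃[ is ] Labels (foldl (flip σ) T is) w
  ∼⇒moves (swap x y w)  (g ∷ h ∷ T) (e ∷ d ∷ p) = zero ∷ [] , d ∷ ρ-conjugate e d ∷ p
  ∼⇒moves (prepend x q) (g ∷ T) (e ∷ p) with ∼⇒moves q T p
  ... | is , r with foldl-σ-∷ g T is
  ...   | js , f = js , subst (λ V → Labels V _) (≡.sym f) (e ∷ r)
  ∼⇒moves ∼-refl        T p = [] , p
  ∼⇒moves (∼-trans q r) T p with ∼⇒moves q T p
  ... | is , p′ with ∼⇒moves r (foldl (flip σ) T is) p′
  ...   | js , p″ = is ++ js , subst (λ V → Labels V _) (≡.sym (foldl-++ (flip σ) T is js)) p″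

  ∼⇒⇝ : ∀ {v w} → v ∼ w → {T V : Vec Carrier n} → Labels T v → Labels V w → T ⇝ V
  ∼⇒⇝ e {T} {V} p q = let is , r = ∼⇒moves e T p in is , labels-≋ _ V r q

  label-∈ : ∀ {Q : Pred Letter 0ℓ} (T : Vec Carrier n) {w g} → Labels T w → All Q w → g ∈ᵛ T →
            ∃[ x ] Q x × g ≈ ρ x
  label-∈ (h ∷ T) (e ∷ p) (q ∷ qs) (Vec.here g≈h) = _ , q , ≈-trans g≈h e
  label-∈ (h ∷ T) (e ∷ p) (q ∷ qs) (Vec.there g∈) = label-∈ T p qs g∈

  ∈-label : ∀ (T : Vec Carrier n) {w x} → Labels T w → x List.∈ w → ρ x ∈ ⟨ T ⟩
  ∈-label (g ∷ T) (e ∷ p) (here ≡.refl) = generator (Vec.here (≈-sym e))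
  ∈-label (g ∷ T) (e ∷ p) (there x∈)    = tail-⊆ (∈-label T p x∈)

  module _ {X : Set} {f : Letter → X} {Q : Pred Letter 0ℓ} (stable : Stable f Q) where
    open Stable stable

    -- Conjugation by `g`, and by its inverse, takes letters in `Q` to letters in `Q` with the same
    -- label. Having both directions makes the property pass to inverses.
    Follows : Carrier → Set
    Follows g = ∀ x → Q x → (∃[ y ] Q y × f x ≡ f y × ρ x ∙ g ≈ g ∙ ρ y) ×
                            (∃[ y ] Q y × f x ≡ f y × ρ y ∙ g ≈ g ∙ ρ x)

    follows-letter : ∀ {z g} → Q z → g ≈ ρ z → Follows g
    follows-letter {z} {g} qz g≈ x qx =
        (x ^ z , closed qx qz , ≡.sym (invariant qx qz) , transfer (ρ-^ x z))
      , (x ^ opposite z , closed qx (opposite-closed qz) , ≡.sym (invariant qx (opposite-closed qz)) ,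
         transfer (subst (λ y → ρ (x ^ opposite z) ∙ ρ z ≈ ρ z ∙ ρ y)
                         (^-opposite x z) (ρ-^ (x ^ opposite z) z)))
      where
      transfer : ∀ {h k} → h ∙ ρ z ≈ ρ z ∙ k → h ∙ g ≈ g ∙ k
      transfer e = ≈-trans (∙-congˡ g≈) (≈-trans e (∙-congʳ (≈-sym g≈)))

    follows-∙ : ∀ {g h} → Follows g → Follows h → Follows (g ∙ h)
    follows-∙ {g} {h} p q x qx with proj₁ (p x qx) | proj₂ (q x qx)
    ... | y , qy , fy , e | y′ , qy′ , fy′ , e′ with proj₁ (q y qy) | proj₂ (p y′ qy′)
    ...   | z , qz , fz , d | z′ , qz′ , fz′ , d′ =
        (z , qz , ≡.trans fy fz , compose e d) , (z′ , qz′ , ≡.trans fy′ fz′ , compose d′ e′)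
      where
      compose : ∀ {a b c} → a ∙ g ≈ g ∙ b → b ∙ h ≈ h ∙ c → a ∙ (g ∙ h) ≈ g ∙ h ∙ c
      compose {a} {b} {c} e d = begin
        a ∙ (g ∙ h)   ≈⟨ assoc _ _ _ ⟨
        a ∙ g ∙ h     ≈⟨ ∙-congʳ e ⟩
        g ∙ b ∙ h     ≈⟨ assoc _ _ _ ⟩
        g ∙ (b ∙ h)   ≈⟨ ∙-congˡ d ⟩
        g ∙ (h ∙ c)   ≈⟨ assoc _ _ _ ⟨
        g ∙ h ∙ c     ∎
        where open SetoidReasoning setoid

    follows-⁻¹ : ∀ {g} → Follows g → Follows (g ⁻¹)
    follows-⁻¹ {g} p x qx with p x qx
    ... | (y , qy , fy , e) , (y′ , qy′ , fy′ , e′) = (y′ , qy′ , fy′ , invert e′) , (y , qy , fy , invert e)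
      where
      invert : ∀ {a b} → a ∙ g ≈ g ∙ b → b ∙ g ⁻¹ ≈ g ⁻¹ ∙ a
      invert {a} {b} e = ∙-cancelˡ g _ _ (begin
        g ∙ (b ∙ g ⁻¹)   ≈⟨ assoc _ _ _ ⟨
        g ∙ b ∙ g ⁻¹     ≈⟨ ∙-congʳ e ⟨
        a ∙ g ∙ g ⁻¹     ≈⟨ //-rightDividesʳ g a ⟩
        a                ≈⟨ \\-leftDividesˡ g a ⟨
        g ∙ (g ⁻¹ ∙ a)   ∎)
        where open SetoidReasoning setoid

    follows-generated : ∀ {Y : Pred Carrier 0ℓ} → (∀ {g} → g ∈ Y → Follows g) →
                        ∀ {g} → g ∈ Generated Y → Follows g
    follows-generated Y⊆ (generator g∈) = Y⊆ g∈
    follows-generated Y⊆ identity x qx  = (x , qx , ≡.refl , unit) , (x , qx , ≡.refl , unit)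
      where unit = ≈-trans (identityʳ _) (≈-sym (identityˡ _))
    follows-generated Y⊆ (product g h)  = follows-∙ (follows-generated Y⊆ g) (follows-generated Y⊆ h)
    follows-generated Y⊆ (inverse g)    = follows-⁻¹ (follows-generated Y⊆ g)
    follows-generated Y⊆ (respects {g} {h} e g∈) x qx with follows-generated Y⊆ g∈ x qx
    ... | (y , qy , fy , d) , (y′ , qy′ , fy′ , d′) =
        (y , qy , fy , transfer d) , (y′ , qy′ , fy′ , transfer d′)
      where
      transfer : ∀ {a b} → a ∙ g ≈ g ∙ b → a ∙ h ≈ h ∙ b
      transfer d = ≈-trans (∙-congˡ (≈-sym e)) (≈-trans d (∙-congʳ e))

    follows-conjugate : ∀ {Y : Pred Carrier 0ℓ} → (∀ {g} → g ∈ Y → Follows g) →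
      ∀ {g h x} → Setoid._≈_ (conjugacy Y) g h → g ≈ ρ x → Q x → ∃[ y ] h ≈ ρ y × Q y × f x ≡ f y
    follows-conjugate Y⊆ {g} {h} {x} (k , k∈ , e) g≈ qx with proj₁ (follows-generated Y⊆ k∈ x qx)
    ... | y , qy , fy , d = y , (begin
      h                     ≈⟨ e ⟨
      k ⁻¹ ∙ g ∙ k          ≈⟨ assoc _ _ _ ⟩
      k ⁻¹ ∙ (g ∙ k)        ≈⟨ ∙-congˡ (≈-trans (∙-congʳ g≈) d) ⟩
      k ⁻¹ ∙ (k ∙ ρ y)      ≈⟨ \\-leftDividesʳ k _ ⟩
      ρ y                   ∎) , qy , fy
      where open SetoidReasoning setoid

    ≡-prep : ∀ {a b : X} {as bs} → a ≡ b → as ↭ bs → a ∷ as ↭ b ∷ bs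
    ≡-prep ≡.refl e = Permutation.prep _ e

    ≡-swap : ∀ {a b c d : X} {as bs} → a ≡ b → c ≡ d → as ↭ bs → a ∷ c ∷ as ↭ d ∷ b ∷ bs
    ≡-swap ≡.refl ≡.refl e = Permutation.swap _ _ e

    -- The middle list of a `trans` step consists of arbitrary group elements, so its letters are
    -- constructed along the way by following the conjugating elements.
    relabel : ∀ {Y : Pred Carrier 0ℓ} → (∀ {g} → g ∈ Y → Follows g) →
      ∀ {gs hs v} → Homogeneous.Permutation (Setoid._≈_ (conjugacy Y)) gs hs →
      Pointwise (λ g x → g ≈ ρ x) gs v → All Q v →
      ∃[ w ] Pointwise (λ g x → g ≈ ρ x) hs w × All Q w × map f v ↭ map f w
    relabel Y⊆ (Homogeneous.refl [])       []      []       = [] , [] , [] , Permutation.↭-refl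
    relabel Y⊆ (Homogeneous.refl (c ∷ cs)) (e ∷ p) (q ∷ qs)
      with follows-conjugate Y⊆ c e q | relabel Y⊆ (Homogeneous.refl cs) p qs
    ... | y , d , qy , fy | w , r , qw , s = y ∷ w , d ∷ r , qy ∷ qw , ≡-prep fy s
    relabel Y⊆ (Homogeneous.prep c cs)     (e ∷ p) (q ∷ qs)
      with follows-conjugate Y⊆ c e q | relabel Y⊆ cs p qs
    ... | y , d , qy , fy | w , r , qw , s = y ∷ w , d ∷ r , qy ∷ qw , ≡-prep fy s
    relabel Y⊆ (Homogeneous.swap c c′ cs)  (e ∷ e′ ∷ p) (q ∷ q′ ∷ qs)
      with follows-conjugate Y⊆ c e q | follows-conjugate Y⊆ c′ e′ q′ | relabel Y⊆ cs p qs
    ... | y , d , qy , fy | y′ , d′ , qy′ , fy′ | w , r , qw , s = y′ ∷ y ∷ w , d′ ∷ d ∷ r , qy′ ∷ qy ∷ qw ,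
      ≡-swap fy fy′ s
    relabel Y⊆ (Homogeneous.trans cs ds) p q with relabel Y⊆ cs p q
    ... | v , r , qv , s with relabel Y⊆ ds r qv
    ...   | w , r′ , qw , s′ = w , r′ , qw , Permutation.trans s s′

    sameClasses⇒↭ : ∀ (T V : Vec Carrier n) {v w} → Labels T v → Labels V w → SameClasses T V →
                    All Q v → map f v ↭ map f w
    sameClasses⇒↭ T V {v} {w} p q same qv
      with relabel (λ g∈ → let x , qx , e = label-∈ T p qv g∈ in follows-letter qx e) same p qv
    ... | w′ , q′ , _ , s with labels-injective q q′
    ...   | ≡.refl = s

  -- Coaxial letters commute, so the group generated by `V` is abelian and the entries of `T` in it
  -- commute; commuting letters are coaxial.
  coaxial-⊆ : ∀ (T V : Vec Carrier n) {v w} → Labels T v → Labels V w → ⟨ T ⟩ ⊆ ⟨ V ⟩ → Coaxial w → Coaxial v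
  coaxial-⊆ T V {v} {w} p q T⊆V (a , coaxial) = commuting v λ x∈ y∈ →
    commute (T⊆V (∈-label T p x∈)) (T⊆V (∈-label T p y∈))
    where
    letters-commute : ∀ {x y} → axis x ≡ a → axis y ≡ a → ρ x ∙ ρ y ≈ ρ y ∙ ρ x
    letters-commute {x} {y} ex ey = subst (λ z → ρ x ∙ ρ y ≈ ρ y ∙ ρ z)
      (resolve (≡.trans ex (≡.sym ey)) (coaxial⇒fixed x y)) (ρ-^ x y)
    entries-commute : ∀ {g h} → g ∈ᵛ V → h ∈ᵛ V → g ∙ h ≈ h ∙ g
    entries-commute g∈ h∈ with label-∈ V q coaxial g∈ | label-∈ V q coaxial h∈
    ... | x , ex , g≈ | y , ey , h≈ = ≈-trans (∙-cong g≈ h≈)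
      (≈-trans (letters-commute ex ey) (∙-cong (≈-sym h≈) (≈-sym g≈)))
    commute : ∀ {g h} → g ∈ ⟨ V ⟩ → h ∈ ⟨ V ⟩ → g ∙ h ≈ h ∙ g
    commute g∈ h∈ = centralized (λ x∈ → ≈-sym (centralized (λ y∈ → entries-commute y∈ x∈) h∈)) g∈
    commuting : ∀ v → (∀ {x y} → x List.∈ v → y List.∈ v → ρ x ∙ ρ y ≈ ρ y ∙ ρ x) → Coaxial v
    commuting []      _ = a , []
    commuting (x ∷ v) c = axis x , ≡.refl ∷ All.tabulate λ {y} y∈ →
      resolve (ρ-injective (∙-cancelˡ (ρ x) _ _ (≈-trans (≈-sym (ρ-^ y x)) (c (there y∈) (here ≡.refl)))))
              (fixed⇒coaxial y x)

  ≅⇒⇝ : ∀ {T V : Vec Carrier n} {v w} → Labels T v → Labels V w → T ≅ V → T ⇝ V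
  ≅⇒⇝ {T = T} {V} {v} {w} p q (e , (T⊆V , V⊆T) , same) = ∼⇒⇝ (classification
    (≈-trans (≈-sym (labels-∏ T p)) (≈-trans e (labels-∏ V q)))
    (λ stable → sameClasses⇒↭ stable T V p q same)
    (coaxial-⊆ T V p q T⊆V)) p q

open import Defs

-- Identification of the reflections of G₇

ℤ⟶ℚ : Embedding ℤ.+-*-commutativeRing ℚ.+-*-commutativeRing
ℤ⟶ℚ = record
  { ⟦_⟧       = fromℤ
  ; ⟦⟧-cong   = cong fromℤ
  ; +-homo    = λ x y → ℚ.toℚᵘ-injective (ℚᵘ.≃-trans
                  (ℚᵘ.*≡* (cong (ℤ._* + 1) (sym (cong₂ ℤ._+_ (ℤ.*-identityʳ x) (ℤ.*-identityʳ y)))))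
                  (ℚᵘ.≃-sym (ℚ.toℚᵘ-homo-+ (fromℤ x) (fromℤ y))))
  ; *-homo    = λ x y → ℚ.toℚᵘ-injective (ℚᵘ.≃-sym (ℚ.toℚᵘ-homo-* (fromℤ x) (fromℤ y)))
  ; 0-homo    = refl
  ; 1-homo    = refl
  ; injective = cong ℚ.numerator
  }

ℤ[√3]⟶ℚ[√3] : Embedding ℤ[√3].commutativeRing ℚ[√3].commutativeRing
ℤ[√3]⟶ℚ[√3] = adjoin {ℤ.+-*-commutativeRing} {ℚ.+-*-commutativeRing} ℤ⟶ℚ {+ 3} {+ 3 ℚ./ 1} refl

O⟶K : Embedding O K
O⟶K = adjoin {ℤ[√3].commutativeRing} {ℚ[√3].commutativeRing} ℤ[√3]⟶ℚ[√3]
             {ℤ[√3].embed -1ℤ} {ℚ[√3].embed (-[1+ 0 ] ℚ./ 1)} (refl , refl)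

module K = CommutativeRing K
open Embedding O⟶K using (⟦_⟧)

int-inverse : ∀ {m} y → y ℚ.* fromℤ m ≡ ℚ.1ℚ →
              ℚ[√3,i].embed (ℚ[√3].embed y) K.* ⟦ int m ⟧ K.≈ K.1#
int-inverse {m} y ym = embed-inverse ℚ[√3].commutativeRing (ℚ[√3].embed (-[1+ 0 ] ℚ./ 1))
  {ℚ[√3].embed y} {ℚ[√3].embed (fromℤ m)}
  (embed-inverse ℚ.+-*-commutativeRing (+ 3 ℚ./ 1) {y} {fromℤ m} ym)

open ScaledRepresentation {O} {K} O⟶K 4ᴼ ¼ (int-inverse {+ 4} (+ 1 ℚ./ 4) refl)

opaque
  Λ-opposite : ∀ l → Λ l M.*ᵐ Λ (opposite l) M.≈ᵐ 4ᴼ M.·ᵐ scalar 4ᴼ ×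
                     Λ (opposite l) M.*ᵐ Λ l M.≈ᵐ 4ᴼ M.·ᵐ scalar 4ᴼ
  Λ-opposite = toWitness {a? = allLetters? λ l → (_ ≟ᵐ _) ×-dec (_ ≟ᵐ _)} _

opaque
  -- This check justifies the labels: the matrices are conjugated as the tetrahedron prescribes.
  Λ-^ : ∀ x y → Λ x M.*ᵐ Λ y M.≈ᵐ Λ y M.*ᵐ Λ (x ^ y)
  Λ-^ = toWitness {a? = allLetters? λ x → allLetters? λ y → _ ≟ᵐ _} _

opaque
  Λ-injective : ∀ x y → x ≡ y ⊎ ¬ Λ x M.≈ᵐ Λ y
  Λ-injective = toWitness {a? = allLetters? λ x → allLetters? λ y → (x ≟ y) ⊎-dec ¬? (_ ≟ᵐ _)} _

ρ : Letter → ∣GL₂∣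
ρ = represent Λ opposite Λ-opposite

-- 4 ζᵏ for ζ = (√3 + i) / 2, a primitive twelfth root of unity.
root : Fin 12 → O.Carrier
root = lookup (ζ⁰ ∷ ζ¹ ∷ ζ² ∷ 4i ∷ ζ⁴ ∷ ζ⁵ ∷ O.- ζ⁰ ∷ O.- ζ¹ ∷ O.- ζ² ∷ O.- 4i ∷ O.- ζ⁴ ∷ O.- ζ⁵ ∷ [])
  where
  ζ⁰ = 4ᴼ
  ζ¹ = quad (+ 0) (+ 2) (+ 2) (+ 0)
  ζ² = quad (+ 2) (+ 0) (+ 0) (+ 2)
  ζ⁴ = quad (ℤ.- (+ 2)) (+ 0) (+ 0) (+ 2)
  ζ⁵ = quad (+ 0) (ℤ.- (+ 2)) (+ 2) (+ 0)

-- Four times representatives of the twelve cosets of the centre of G₇.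
core : Fin 3 × Fin 4 → M.Matrix
core (0F , 0F)    = scalar 4ᴼ
core (0F , suc e) = Λ (edge (e ↑ˡ 3))
core (1F , v)     = Λ (rot 0F v)
core (2F , v)     = Λ (rot 1F v)

opaque
  root-* : ∀ j k → ∃[ m ] root j O.* root k O.≈ 4ᴼ O.* root m
  root-* = toWitness {a? = Fin.all? λ j → Fin.all? λ k → Fin.any? λ m → _ ≟ᴼ _} _

open Elements root core root-*

-- The letters of `s`, `t` and `u`. Transposing `t` at vertex 0 gives `u` at `translate 1F 0F`,
-- which is `2F`.
generators : Fin 3 → Letter
generators = lookup (edge 2F ∷ rot 0F 0F ∷ rot 3F 2F ∷ [])

opaque
  -- Coset enumeration: a generator takes each representative to another one up to a central root of
  -- unity.
  core-* : ∀ a p q → ∃[ r ] ∃[ p′ ] ∃[ q′ ] core (p , q) M.*ᵐ Λ (generators a) M.≈ᵐ root r M.·ᵐ core (p′ , q′)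
  core-* = toWitness {a? = Fin.all? λ a → Fin.all? λ p → Fin.all? λ q →
    Fin.any? λ r → Fin.any? λ p′ → Fin.any? λ q′ → _ ≟ᵐ _} _

conjugate√3 : ℤ[√3].Carrier → ℤ[√3].Carrier
conjugate√3 (x ℤ[√3].⊕ y √d) = x ℤ[√3].⊕ ℤ.- y √d

-- Chosen such that cofactor x * x is the norm of x from ℚ(√3, i) to ℚ.
cofactor : O.Carrier → O.Carrier
cofactor x = conjugate x O.* ℤ[√3,i].embed (conjugate√3 (ℤ[√3,i].base (conjugate x O.* x)))

norm : O.Carrier → ℤ
norm x = ℤ[√3].base (ℤ[√3,i].base (cofactor x O.* x))

-- The norm identity is part of the check and is evaluated for each determinant in question; a
-- nonzero integer is then inverted in the rationals.
RegularCheck : O.Carrier → Set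
RegularCheck e = cofactor e O.* e O.≈ int (norm e) × ¬ norm e ≡ 0ℤ

regularCheck? : ∀ e → Dec (RegularCheck e)
regularCheck? e = (cofactor e O.* e ≟ᴼ int (norm e)) ×-dec ¬? (norm e ℤ.≟ 0ℤ)

regularCheck⇒invertible : ∀ e → RegularCheck e → Invertible e
regularCheck⇒invertible e (product≈ , norm≢0) = invertible {cofactor e} {e} {int m}
  {ℚ[√3,i].embed (ℚ[√3].embed (ℚ.1/ fromℤ m))}
  product≈ (int-inverse {m} (ℚ.1/ fromℤ m) (ℚ.*-inverseˡ (fromℤ m)))
  where
  m = norm e
  instance
    m≢0 : ℚ.NonZero (fromℤ m)
    m≢0 = ℚ.≢-nonZero λ eq → norm≢0 (cong ℚ.numerator {fromℤ m} {ℚ.0ℚ} eq)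

allPairs? : ∀ {m n} {P : Fin m × Fin n → Set} → (∀ q → Dec (P q)) → Dec (∀ q → P q)
allPairs? P? = map′ (λ f (i , j) → f i j) (λ f i j → f (i , j)) (Fin.all? λ i → Fin.all? λ j → P? (i , j))

opaque
  -- All 144 products of a root and a core are inspected: each lacks the eigenvalue 1, is the
  -- identity, or is one of the 22 listed reflections.
  classify : ∀ r q →
    RegularCheck (shiftedDet (element r q)) ⊎
    element r q M.≈ᵐ 4ᴼ M.·ᵐ scalar 4ᴼ ⊎
    ∃[ l ] element r q M.≈ᵐ 4ᴼ M.·ᵐ Λ l
  classify = toWitness {a? = Fin.all? λ r → allPairs? λ q →
    regularCheck? (shiftedDet (element r q)) ⊎-dec
    (element r q ≟ᵐ 4ᴼ M.·ᵐ scalar 4ᴼ) ⊎-dec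
    anyLetter? λ l → element r q ≟ᵐ 4ᴼ M.·ᵐ Λ l} _

1≉0 : ¬ K.1# K.≈ K.0#
1≉0 ((() , _) , _)

element⇒letter : ∀ {A} → Element A → IsReflection A → ∃[ l ] A ≈ᵐ MatrixEmbedding.scale O⟶K ¼ (Λ l)
element⇒letter = reflection⇒letter Λ 1≉0 {RegularCheck} regularCheck⇒invertible classify

private
  pattern coordinatewise = (refl , refl) , (refl , refl)
  pattern entrywise =
    (coordinatewise , coordinatewise) , (coordinatewise , coordinatewise)

open Group GL₂ using () renaming (_≈_ to _≈ᵍ_)

letter-preserving : ∀ a → Preserving (MatrixEmbedding.scale O⟶K ¼ (Λ (generators a)))
letter-preserving a = preserving-scale {Λ (generators a)} λ (p , q) →
  let r , p′ , q′ , eq = core-* a p q in r , (p′ , q′) , eq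

s-preserving : PreservingUnit s
s-preserving = preservingUnit s (letter-preserving 0F) entrywise (inj₁ entrywise)

t-preserving : PreservingUnit t
t-preserving = preservingUnit t (letter-preserving 1F) entrywise (inj₂ entrywise)

u-preserving : PreservingUnit u
u-preserving = preservingUnit u (letter-preserving 2F) entrywise (inj₂ entrywise)

generators-preserving : ∀ {g} → Membership._∈_ (Group.setoid GL₂) g (s ∷ t ∷ u ∷ []) → PreservingUnit g
generators-preserving {g} (Vec.here g≈s) = preservingUnit-≈ {g} {s} g≈s s-preserving
generators-preserving {g} (Vec.there (Vec.here g≈t)) = preservingUnit-≈ {g} {t} g≈t t-preserving
generators-preserving {g} (Vec.there (Vec.there (Vec.here g≈u))) = preservingUnit-≈ {g} {u} g≈u u-preserving

1ᵐ-element : Element 1ᵐ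
1ᵐ-element = 0F , (0F , 0F) , entrywise

reflections-of-G₇ : ∀ {g} → g ∈ G₇ → IsReflection (val g) → ∃[ l ] g ≈ᵍ ρ l
reflections-of-G₇ {g} g∈G₇ = element⇒letter {val g}
  (generated-element (λ {h} → generators-preserving {h}) 1ᵐ-element {g} g∈G₇)

-- The faithful labelling of the reflections and the conclusion

module GL₂ = Group GL₂

ρ-^ : ∀ x y → ρ x GL₂.∙ ρ y GL₂.≈ ρ y GL₂.∙ ρ (x ^ y)
ρ-^ x y = represent-pair Λ opposite Λ-opposite {x} {y} {y} {x ^ y} (Λ-^ x y)

ρ-injective : ∀ {x y} → ρ x GL₂.≈ ρ y → x ≡ y
ρ-injective {x} {y} e with Λ-injective x y
... | inj₁ x≡y    = x≡y
... | inj₂ Λx≉Λy = contradiction (represent-injective Λ opposite Λ-opposite {x} {y} e) Λx≉Λy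

ρ-pair : ∀ x y x′ y′ → ρ x GL₂.∙ ρ y GL₂.≈ ρ x′ GL₂.∙ ρ y′ → ¬ Distinct x y x′ y′
ρ-pair x y x′ y′ e d = products-differ d (represent-pair⁻ Λ opposite Λ-opposite {x} {y} {x′} {y′} e)

ρ-triple : ∀ x y z x′ y′ z′ → ρ x GL₂.∙ (ρ y GL₂.∙ ρ z) GL₂.≈ ρ x′ GL₂.∙ (ρ y′ GL₂.∙ ρ z′) →
           ¬ Distinct₃ x y z x′ y′ z′
ρ-triple x y z x′ y′ z′ e d =
  products-differ₃ d (represent-triple⁻ Λ opposite Λ-opposite {x} {y} {z} {x′} {y′} {z′} e)

labelling : FaithfulLabelling GL₂ ρ
labelling = record
  { ρ-^         = ρ-^
  ; ρ-injective = λ {x} {y} → ρ-injective {x} {y}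
  ; ρ-pair      = ρ-pair
  ; ρ-triple    = ρ-triple
  }

open Labelled GL₂ ρ labelling using (Labels; ≅⇒⇝)

labels : ∀ {n} (T : Vec ∣GL₂∣ n) → IsReflectionFactorizationIn G₇ T → ∃[ w ] Labels T w
labels []      []                        = [] , []
labels (g ∷ T) ((reflection , g∈G₇) ∷ p) =
  let x , e = reflections-of-G₇ {g} g∈G₇ reflection; w , q = labels T p in x ∷ w , e ∷ q

theorem1p2 : (n : ℕ) (T V : Vec ∣GL₂∣ n) →
    IsReflectionFactorizationIn G₇ T →
    IsReflectionFactorizationIn G₇ V →
    T ≃ V ⇔ (Group._≈_ GL₂ (∏ T) (∏ V) × ⟨ T ⟩ ≐ ⟨ V ⟩ × SameClasses T V)
theorem1p2 n T V p q = mk⇔ (HurwitzInvariants.≃⇒≅ GL₂)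
  (λ e → inj₁ (≅⇒⇝ {n} {T} {V} (proj₂ (labels T p)) (proj₂ (labels V q)) e))
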